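{- Let $\alpha>0$ be a constant and let $0<c<\alpha$ be any constant. Let $G$ be an $n$-vertex graph with minimum degree at least $\alpha n$. Then in the RandomWalker game on $G$, Breaker has a strategy such that with high probability (i.e. with probability tending to $1$ as $n\to\infty$) RandomWalker visits at most $n-c\log n$ vertices.
   Context: The RandomWalker game on a graph $G$: RandomWalker starts at a vertex of $G$ (which counts as visited), and moves alternate with Breaker's moves. On Breaker's move he acquires one edge of $G$ (not yet traversed by the walker). On RandomWalker's move, if she is at vertex $v$, she moves to a neighbour $w$ of $v$ chosen uniformly at random among those $w$ for which the edge $vw$ has not been acquired by Breaker; $w$ becomes visited. The game ends when there is no path from RandomWalker's current position to an unvisited vertex along edges not acquired by Breaker. Breaker aims to minimize the number of vertices visited. -}

module Defs where

open import Data.Bool using (Bool; true; false; if_then_else_; _∧_; _∨_; not)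
open import Data.Nat as ℕ using (ℕ; zero; suc; _∸_; _≤ᵇ_)
open import Data.Integer using (+_)
open import Data.Fin using (Fin; _≟_)
open import Data.List using (List; []; _∷_; map; foldr; length; filterᵇ; allFin)
open import Data.Bool.ListAction using (any)
open import Data.Product using (Σ; _×_; _,_)
open import Data.Rational using (ℚ; 0ℚ; 1ℚ; _+_; _*_; _/_; _÷_; _≤_; _<_; positive)
open import Data.Rational.Properties using (pos⇒nonZero)
open import Relation.Nullary.Decidable using (⌊_⌋)
open import Relation.Binary.PropositionalEquality using (_≡_)

record Graph (n : ℕ) : Set where
  field
    adj    : Fin n → Fin n → Bool
    sym    : ∀ u v → adj u v ≡ adj v u
    irrefl : ∀ v → adj v v ≡ false
open Graph public

card : {n : ℕ} → (Fin n → Bool) → ℕ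
card {n} P = length (filterᵇ P (allFin n))

degree : {n : ℕ} → Graph n → Fin n → ℕ
degree G v = card (adj G v)

ℕ→ℚ : ℕ → ℚ
ℕ→ℚ m = (+ m) / 1

MinDegreeAtLeast : {n : ℕ} → Graph n → ℚ → Set
MinDegreeAtLeast {n} G α = ∀ v → α * ℕ→ℚ n ≤ ℕ→ℚ (degree G v)

_^ℚ_ : ℚ → ℕ → ℚ
y ^ℚ zero  = 1ℚ
y ^ℚ suc j = y * (y ^ℚ j)

fact : ℕ → ℕ
fact zero    = 1
fact (suc j) = suc j ℕ.* fact j

term : ℚ → ℕ → ℚ
term y j = y ^ℚ j * ((+ 1) / suc (ℕ.pred (fact j)))   -- fact j ≥ 1, so this is 1 / j!

expPartial : ℚ → ℕ → ℚ
expPartial y zero    = 0ℚ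
expPartial y (suc K) = expPartial y K + term y K

-- LnLe n y  means  ln n ≤ y  (for y ≥ 0), i.e. n ≤ e^y.
-- Since the partial sums increase to e^y and e^y is irrational for
-- rational y ≠ 0, n ≤ e^y  iff some partial sum is ≥ n.
LnLe : ℕ → ℚ → Set
LnLe n y = Σ ℕ λ K → ℕ→ℚ n ≤ expPartial y K

CLnLe : (c : ℚ) → 0ℚ < c → ℕ → ℕ → Set
CLnLe c cpos n m = LnLe n ((ℕ→ℚ m ÷ c) {{pos⇒nonZero c {{positive cpos}}}})

-- A (deterministic) Breaker strategy: given the history of RandomWalker's
-- positions (most recent first, starting vertex last), name an edge {a,b}
-- to acquire.  Breaker's own earlier moves are determined by the strategy,
-- so this is the full game history.
Strategy : ℕ → Set
Strategy n = List (Fin n) → Fin n × Fin n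

record State (n : ℕ) : Set where
  field
    pos  : Fin n
    vis  : Fin n → Bool
    acq  : Fin n → Fin n → Bool
    trav : Fin n → Fin n → Bool
    hist : List (Fin n)
open State public

_==_ : {n : ℕ} → Fin n → Fin n → Bool
a == b = ⌊ a ≟ b ⌋

sumℚ : List ℚ → ℚ
sumℚ = foldr _+_ 0ℚ

avg : List ℚ → ℚ
avg []       = 0ℚ
avg (x ∷ xs) = sumℚ (x ∷ xs) * ((+ 1) / suc (length xs))

module Game {n : ℕ} (G : Graph n) (σ : Strategy n) (t : ℕ) where

  usable : State n → Fin n → Fin n → Bool
  usable s u v = adj G u v ∧ not (acq s u v)

  reach : State n → ℕ → Fin n → Bool
  reach s zero    x = x == pos s
  reach s (suc k) x = reach s k x ∨ any (λ y → reach s k y ∧ usable s y x) (allFin n)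

  over : State n → Bool
  over s = not (any (λ x → reach s n x ∧ not (vis s x)) (allFin n))

  outcome : State n → ℚ
  outcome s = if card (vis s) ≤ᵇ t then 1ℚ else 0ℚ

  move : State n → Fin n → State n
  move s w = record
    { pos  = w
    ; vis  = λ x → vis s x ∨ (x == w)
    ; acq  = acq s
    ; trav = λ a b → trav s a b ∨ ((a == pos s) ∧ (b == w)) ∨ ((a == w) ∧ (b == pos s))
    ; hist = w ∷ hist s
    }

  acquire : State n → Fin n → Fin n → State n
  acquire s a b = record
    { pos  = pos s
    ; vis  = vis s
    ; acq  = λ x y → acq s x y ∨ ((x == a) ∧ (y == b)) ∨ ((x == b) ∧ (y == a))
    ; trav = trav s
    ; hist = hist s
    }

  legal : State n → Fin n → Fin n → Bool
  legal s a b = adj G a b ∧ not (acq s a b) ∧ not (trav s a b)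

  -- probability (under Breaker strategy σ) that the game ends with at most
  -- t visited vertices; an illegal Breaker move, or running out of fuel,
  -- counts as failure (value 0).
  walkerTurn  : ℕ → State n → ℚ
  breakerTurn : ℕ → State n → ℚ
  walkerTurn zero    s = 0ℚ
  walkerTurn (suc f) s =
    if over s then outcome s
    else avg (map (λ w → breakerTurn f (move s w)) (filterᵇ (usable s (pos s)) (allFin n)))
  breakerTurn f s with σ (hist s)
  ... | (a , b) =
    if over s then outcome s
    else (if legal s a b then walkerTurn f (acquire s a b) else 0ℚ)

  initial : Fin n → State n
  initial v = record
    { pos = v ; vis = λ x → x == v ; acq = λ _ _ → false
    ; trav = λ _ _ → false ; hist = v ∷ [] }

-- Probability that RandomWalker, starting at v (and moving first), visits at
-- most t vertices when Breaker plays σ.  Every round acquires a new edge, so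
-- the game lasts at most (#edges + 1) ≤ n*n + 1 walker turns: the fuel
-- suc (n * n) never runs out.
probAtMost : {n : ℕ} → Graph n → Strategy n → Fin n → ℕ → ℚ
probAtMost {n} G σ v t = Game.walkerTurn G σ t (suc (n ℕ.* n)) (Game.initial G σ t v)

{-# OPTIONS --safe #-}

-- Breaker protects unvisited vertices one at a time. His target is always the least unvisited
-- vertex with a usable edge, and he takes the edge from the walker's position to it whenever that
-- edge is usable, and any other usable edge at the target otherwise. The walker thus never enters
-- the target, and after at most n moves it is isolated for good, so at most n L moves protect L
-- vertices, provided that many unvisited vertices are left.
--
-- If W vertices are unvisited and the walker has D exits, the expected value of 1 / (W + 1) grows
-- at most by the factor 1 + 1 / D in one step, since at most W exits lead to unvisited vertices. All
-- edges taken meet protected vertices, so D ≥ α n - L ≥ a n for some c < a < α. By Markov's inequality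
-- the walker leaves fewer than L vertices within n L steps with probability at most
-- L (1 + x / n) ^ (n L) / n with x = 1 / a. For y = 1 / c > x and L the least exponent with
-- (1 + y / n) ^ (n L) ≥ n, so that L ≥ c ln n, this bound tends to 0.
module Submission where

open import Defs
open import Data.Nat using (ℕ; _≤_; _∸_)
open import Data.Fin using (Fin)
open import Data.Product using (Σ; _×_)
open import Data.Rational using (ℚ; 0ℚ; 1ℚ; _<_; _-_)
open import Data.Rational as Q using ()

open import Algebra.Properties.CommutativeSemigroup using (interchange)
open import Data.Bool using (Bool; true; false; if_then_else_; _∧_; _∨_; not; T; T?)
open import Data.Bool.ListAction using (any)
open import Data.Bool.Properties using (T-∧; T-∨; T-≡)
open import Data.Empty using (⊥; ⊥-elim)
open import Data.Fin as Fin using (toℕ; _≟_)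
import Data.Fin.Properties as Finₚ
import Data.Integer as ℤ
import Data.Integer.Properties as ℤₚ
open import Data.List using (List; []; _∷_; map; length; filterᵇ; allFin)
open import Data.List.Membership.Propositional using (_∈_; lose; find)
open import Data.List.Membership.Propositional.Properties using (∈-allFin; ∈-filter⁻; ∈-filter⁺)
open import Data.List.Properties using (length-map; length-tabulate)
open import Data.List.Relation.Unary.All using (_∷_)
open import Data.List.Relation.Unary.AllPairs using (_∷_)
open import Data.List.Relation.Unary.Any using (here; there)
open import Data.List.Relation.Unary.Any.Properties using (any⁺; any⁻)
open import Data.List.Relation.Unary.Unique.Propositional using (Unique)
open import Data.List.Relation.Unary.Unique.Propositional.Properties using (allFin⁺; filter⁺)
open import Data.Nat as ℕ using (zero; suc; z≤n; s≤s)
open import Data.Nat.ListAction using (sum)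
import Data.Nat.Properties as ℕₚ
open import Data.Product using (∃; _,_; proj₁; proj₂)
open import Data.Rational using (_+_; _*_; -_; _/_; 1/_)
import Data.Rational.Properties as Qₚ
open import Data.Rational.Solver using (module +-*-Solver)
open +-*-Solver using (solve; _:+_; _:*_; _:-_; _:=_; con)
import Data.Rational.Unnormalised as ℚᵘ
import Data.Rational.Unnormalised.Properties as ℚᵘₚ
open import Data.Sum as Sum using (_⊎_; inj₁; inj₂; [_,_])
open import Function using (_∘_; id; Equivalence)
open import Relation.Binary.PropositionalEquality hiding ([_]) renaming (sym to ≡-sym)
open import Relation.Nullary using (¬_; Dec; yes; no)
open import Relation.Nullary.Decidable using (toWitness; fromWitness)

-- Powers and exponential sums of rationals

-- The shift keeps the denominator positive: `inv m` is 1 / n for n = m + 1, and `inv W` is the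
-- quantity 1 / (W + 1) whose expectation is tracked.
inv : ℕ → ℚ
inv k = (ℤ.+ 1) / suc k

toℚᵘ-ℕ→ℚ : ∀ m → Q.toℚᵘ (ℕ→ℚ m) ℚᵘ.≃ ℚᵘ.mkℚᵘ (ℤ.+ m) 0
toℚᵘ-ℕ→ℚ m = Qₚ.toℚᵘ-fromℚᵘ (ℚᵘ.mkℚᵘ (ℤ.+ m) 0)

ℕ→ℚ-+ : ∀ m n → ℕ→ℚ (m ℕ.+ n) ≡ ℕ→ℚ m + ℕ→ℚ n
ℕ→ℚ-+ m n = Qₚ.toℚᵘ-injective (begin
  Q.toℚᵘ (ℕ→ℚ (m ℕ.+ n))                        ≈⟨ toℚᵘ-ℕ→ℚ (m ℕ.+ n) ⟩
  ℚᵘ.mkℚᵘ (ℤ.+ (m ℕ.+ n)) 0                     ≈⟨ ℚᵘ.*≡* (cong (ℤ._* ℤ.+ 1) (cong₂ ℤ._+_ (ℤₚ.*-identityʳ (ℤ.+ m)) (ℤₚ.*-identityʳ (ℤ.+ n)))) ⟨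
  ℚᵘ.mkℚᵘ (ℤ.+ m) 0 ℚᵘ.+ ℚᵘ.mkℚᵘ (ℤ.+ n) 0       ≈⟨ ℚᵘₚ.+-cong (toℚᵘ-ℕ→ℚ m) (toℚᵘ-ℕ→ℚ n) ⟨
  Q.toℚᵘ (ℕ→ℚ m) ℚᵘ.+ Q.toℚᵘ (ℕ→ℚ n)             ≈⟨ Qₚ.toℚᵘ-homo-+ (ℕ→ℚ m) (ℕ→ℚ n) ⟨
  Q.toℚᵘ (ℕ→ℚ m + ℕ→ℚ n)                        ∎)
  where open ℚᵘₚ.≃-Reasoning

ℕ→ℚ-mono : ∀ {m n} → m ≤ n → ℕ→ℚ m Q.≤ ℕ→ℚ n
ℕ→ℚ-mono {m} {n} m≤n = Qₚ.toℚᵘ-cancel-≤ (begin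
  Q.toℚᵘ (ℕ→ℚ m)       ≃⟨ toℚᵘ-ℕ→ℚ m ⟩
  ℚᵘ.mkℚᵘ (ℤ.+ m) 0    ≤⟨ ℚᵘ.*≤* (ℤₚ.*-monoʳ-≤-nonNeg (ℤ.+ 1) (ℤ.+≤+ m≤n)) ⟩
  ℚᵘ.mkℚᵘ (ℤ.+ n) 0    ≃⟨ toℚᵘ-ℕ→ℚ n ⟨
  Q.toℚᵘ (ℕ→ℚ n)       ∎)
  where open ℚᵘₚ.≤-Reasoning

inv-inverse : ∀ k → inv k * ℕ→ℚ (suc k) ≡ 1ℚ
inv-inverse k = Qₚ.toℚᵘ-injective (begin
  Q.toℚᵘ (inv k * ℕ→ℚ (suc k))                     ≈⟨ Qₚ.toℚᵘ-homo-* (inv k) (ℕ→ℚ (suc k)) ⟩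
  Q.toℚᵘ (inv k) ℚᵘ.* Q.toℚᵘ (ℕ→ℚ (suc k))         ≈⟨ ℚᵘₚ.*-cong (Qₚ.toℚᵘ-fromℚᵘ (ℚᵘ.mkℚᵘ (ℤ.+ 1) k)) (toℚᵘ-ℕ→ℚ (suc k)) ⟩
  ℚᵘ.mkℚᵘ (ℤ.+ 1) k ℚᵘ.* ℚᵘ.mkℚᵘ (ℤ.+ suc k) 0     ≈⟨ ℚᵘ.*≡* (cong ℤ.+_ eq) ⟩
  Q.toℚᵘ 1ℚ                                        ∎)
  where
  open ℚᵘₚ.≃-Reasoning
  eq : (suc k ℕ.+ 0) ℕ.* 1 ≡ suc (k ℕ.* 1) ℕ.+ 0
  eq = trans (ℕₚ.*-identityʳ _) (cong (λ j → suc j ℕ.+ 0) (≡-sym (ℕₚ.*-identityʳ k)))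

0≤inv : ∀ k → 0ℚ Q.≤ inv k
0≤inv k = Qₚ.nonNegative⁻¹ (inv k) {{Qₚ.normalize-nonNeg 1 (suc k)}}

0≤ℕ→ℚ : ∀ m → 0ℚ Q.≤ ℕ→ℚ m
0≤ℕ→ℚ m = ℕ→ℚ-mono {0} {m} z≤n

≤-by-difference : ∀ {p q} r → 0ℚ Q.≤ r → p + r ≡ q → p Q.≤ q
≤-by-difference {p} r 0≤r refl = Qₚ.≤-trans (Qₚ.≤-reflexive (≡-sym (Qₚ.+-identityʳ p))) (Qₚ.+-monoʳ-≤ p 0≤r)

*-monoˡ : ∀ {r p q} → 0ℚ Q.≤ r → p Q.≤ q → r * p Q.≤ r * q
*-monoˡ {r} 0≤r = Qₚ.*-monoˡ-≤-nonNeg r {{Q.nonNegative 0≤r}}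

*-monoʳ : ∀ {r p q} → 0ℚ Q.≤ r → p Q.≤ q → p * r Q.≤ q * r
*-monoʳ {r} 0≤r = Qₚ.*-monoʳ-≤-nonNeg r {{Q.nonNegative 0≤r}}

*-mono : ∀ {p q r s} → 0ℚ Q.≤ p → 0ℚ Q.≤ s → p Q.≤ q → r Q.≤ s → p * r Q.≤ q * s
*-mono 0≤p 0≤s p≤q r≤s = Qₚ.≤-trans (*-monoˡ 0≤p r≤s) (*-monoʳ 0≤s p≤q)

0≤* : ∀ {p q} → 0ℚ Q.≤ p → 0ℚ Q.≤ q → 0ℚ Q.≤ p * q
0≤* {p} {q} 0≤p 0≤q = subst (Q._≤ p * q) (Qₚ.*-zeroʳ p) (*-monoˡ 0≤p 0≤q)

0≤+ : ∀ {p q} → 0ℚ Q.≤ p → 0ℚ Q.≤ q → 0ℚ Q.≤ p + q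
0≤+ 0≤p 0≤q = Qₚ.+-mono-≤ 0≤p 0≤q

*-cancelˡ : ∀ {r p q} → 0ℚ < r → r * p Q.≤ r * q → p Q.≤ q
*-cancelˡ {r} 0<r = Qₚ.*-cancelˡ-≤-pos r {{Q.positive 0<r}}


ℕ→ℚ-* : ∀ m n → ℕ→ℚ (m ℕ.* n) ≡ ℕ→ℚ m * ℕ→ℚ n
ℕ→ℚ-* zero    n = ≡-sym (Qₚ.*-zeroˡ (ℕ→ℚ n))
ℕ→ℚ-* (suc m) n = begin
  ℕ→ℚ (n ℕ.+ m ℕ.* n)              ≡⟨ ℕ→ℚ-+ n (m ℕ.* n) ⟩
  ℕ→ℚ n + ℕ→ℚ (m ℕ.* n)            ≡⟨ cong (ℕ→ℚ n +_) (ℕ→ℚ-* m n) ⟩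
  ℕ→ℚ n + ℕ→ℚ m * ℕ→ℚ n            ≡⟨ solve 2 (λ a b → b :+ a :* b := (con 1ℚ :+ a) :* b) refl (ℕ→ℚ m) (ℕ→ℚ n) ⟩
  (1ℚ + ℕ→ℚ m) * ℕ→ℚ n             ≡⟨ cong (_* ℕ→ℚ n) (ℕ→ℚ-+ 1 m) ⟨
  ℕ→ℚ (suc m) * ℕ→ℚ n              ∎
  where open ≡-Reasoning

reciprocal : ∀ {p} → 0ℚ < p → Σ ℚ λ r → 0ℚ < r × p * r ≡ 1ℚ
reciprocal {p} 0<p = r , Qₚ.positive⁻¹ r {{Qₚ.1/pos⇒pos p}} , Qₚ.*-inverseʳ p
  where
  instance
    _ = Q.positive 0<p
    _ = Qₚ.pos⇒nonZero p
  r = 1/ p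

archimedean : ∀ p → Σ ℕ λ m → p Q.≤ ℕ→ℚ m
archimedean p@(Q.mkℚ i d _) = ℤ.∣ i ∣ , Qₚ.toℚᵘ-cancel-≤ (ℚᵘₚ.≤-trans (ℚᵘ.*≤* le) (ℚᵘₚ.≤-reflexive (ℚᵘₚ.≃-sym (toℚᵘ-ℕ→ℚ ℤ.∣ i ∣))))
  where
  i≤∣i∣ : ∀ j → j ℤ.≤ ℤ.+ ℤ.∣ j ∣
  i≤∣i∣ (ℤ.+ _)      = ℤₚ.≤-refl
  i≤∣i∣ ℤ.-[1+ _ ]   = ℤ.-≤+
  le : i ℤ.* ℤ.+ 1 ℤ.≤ ℤ.+ ℤ.∣ i ∣ ℤ.* ℤ.+ suc d
  le = ℤₚ.≤-trans (ℤₚ.≤-reflexive (ℤₚ.*-identityʳ i)) (ℤₚ.≤-trans (i≤∣i∣ i)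
         (ℤₚ.≤-trans (ℤ.+≤+ (ℕₚ.m≤m*n ℤ.∣ i ∣ (suc d))) (ℤₚ.≤-reflexive (ℤₚ.pos-* ℤ.∣ i ∣ (suc d)))))

0≤1 : 0ℚ Q.≤ 1ℚ
0≤1 = 0≤ℕ→ℚ 1

1≤1+ : ∀ {w} → 0ℚ Q.≤ w → 1ℚ Q.≤ 1ℚ + w
1≤1+ {w} 0≤w = ≤-by-difference w 0≤w refl

0≤1+ : ∀ {w} → 0ℚ Q.≤ w → 0ℚ Q.≤ 1ℚ + w
0≤1+ 0≤w = 0≤+ 0≤1 0≤w

0≤^ : ∀ {p} → 0ℚ Q.≤ p → ∀ k → 0ℚ Q.≤ p ^ℚ k
0≤^ 0≤p zero    = 0≤1
0≤^ 0≤p (suc k) = 0≤* 0≤p (0≤^ 0≤p k)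

^-mono : ∀ {p q} → 0ℚ Q.≤ p → p Q.≤ q → ∀ k → p ^ℚ k Q.≤ q ^ℚ k
^-mono 0≤p p≤q zero    = Qₚ.≤-refl
^-mono 0≤p p≤q (suc k) = *-mono 0≤p (0≤^ (Qₚ.≤-trans 0≤p p≤q) k) p≤q (^-mono 0≤p p≤q k)

1^ : ∀ k → 1ℚ ^ℚ k ≡ 1ℚ
1^ zero    = refl
1^ (suc k) = trans (Qₚ.*-identityˡ _) (1^ k)

1≤^ : ∀ {p} → 1ℚ Q.≤ p → ∀ k → 1ℚ Q.≤ p ^ℚ k
1≤^ {p} 1≤p k = subst (Q._≤ p ^ℚ k) (1^ k) (^-mono 0≤1 1≤p k)

^-+ : ∀ p m n → p ^ℚ (m ℕ.+ n) ≡ p ^ℚ m * p ^ℚ n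
^-+ p zero    n = ≡-sym (Qₚ.*-identityˡ _)
^-+ p (suc m) n = trans (cong (p *_) (^-+ p m n)) (≡-sym (Qₚ.*-assoc p (p ^ℚ m) (p ^ℚ n)))

^-distrib-* : ∀ p q k → (p * q) ^ℚ k ≡ p ^ℚ k * q ^ℚ k
^-distrib-* p q zero    = refl
^-distrib-* p q (suc k) = trans (cong ((p * q) *_) (^-distrib-* p q k))
  (solve 4 (λ a b c d → a :* b :* (c :* d) := a :* c :* (b :* d)) refl p q (p ^ℚ k) (q ^ℚ k))

^-* : ∀ p m n → p ^ℚ (m ℕ.* n) ≡ (p ^ℚ m) ^ℚ n
^-* p zero    n = ≡-sym (1^ n)
^-* p (suc m) n = begin
  p ^ℚ (n ℕ.+ m ℕ.* n)        ≡⟨ ^-+ p n (m ℕ.* n) ⟩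
  p ^ℚ n * p ^ℚ (m ℕ.* n)     ≡⟨ cong (p ^ℚ n *_) (^-* p m n) ⟩
  p ^ℚ n * (p ^ℚ m) ^ℚ n      ≡⟨ ^-distrib-* p (p ^ℚ m) n ⟨
  (p ^ℚ suc m) ^ℚ n           ∎
  where open ≡-Reasoning

^-monoʳ : ∀ {p m n} → 1ℚ Q.≤ p → m ≤ n → p ^ℚ m Q.≤ p ^ℚ n
^-monoʳ {p} {m} {n} 1≤p m≤n = begin
  p ^ℚ m                       ≡⟨ Qₚ.*-identityʳ _ ⟨
  p ^ℚ m * 1ℚ                  ≤⟨ *-monoˡ (0≤^ (Qₚ.≤-trans 0≤1 1≤p) m) (1≤^ 1≤p (n ∸ m)) ⟩
  p ^ℚ m * p ^ℚ (n ∸ m)        ≡⟨ ^-+ p m (n ∸ m) ⟨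
  p ^ℚ (m ℕ.+ (n ∸ m))         ≡⟨ cong (p ^ℚ_) (ℕₚ.m+[n∸m]≡n m≤n) ⟩
  p ^ℚ n                       ∎
  where open Qₚ.≤-Reasoning

bernoulli : ∀ {w} → 0ℚ Q.≤ w → ∀ k → 1ℚ + ℕ→ℚ k * w Q.≤ (1ℚ + w) ^ℚ k
bernoulli {w} 0≤w zero    = Qₚ.≤-reflexive (trans (cong (1ℚ +_) (Qₚ.*-zeroˡ w)) (Qₚ.+-identityʳ 1ℚ))
bernoulli {w} 0≤w (suc k) = begin
  1ℚ + ℕ→ℚ (suc k) * w            ≡⟨ cong (λ z → 1ℚ + z * w) (ℕ→ℚ-+ 1 k) ⟩
  1ℚ + (1ℚ + ℕ→ℚ k) * w           ≤⟨ ≤-by-difference (ℕ→ℚ k * (w * w)) (0≤* (0≤ℕ→ℚ k) (0≤* 0≤w 0≤w))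
    (solve 2 (λ w k → (con 1ℚ :+ (con 1ℚ :+ k) :* w) :+ k :* (w :* w) := (con 1ℚ :+ w) :* (con 1ℚ :+ k :* w)) refl w (ℕ→ℚ k)) ⟩
  (1ℚ + w) * (1ℚ + ℕ→ℚ k * w)     ≤⟨ *-monoˡ (0≤1+ 0≤w) (bernoulli 0≤w k) ⟩
  (1ℚ + w) ^ℚ suc k               ∎
  where open Qₚ.≤-Reasoning

-- Partial sums of the exponential series

invFact : ℕ → ℚ
invFact j = inv (ℕ.pred (fact j))

1≤fact : ∀ j → 1 ≤ fact j
1≤fact zero    = ℕₚ.≤-refl
1≤fact (suc j) = ℕₚ.≤-trans (1≤fact j) (ℕₚ.m≤n*m (fact j) (suc j))

invFact-inverse : ∀ j → invFact j * ℕ→ℚ (fact j) ≡ 1ℚ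
invFact-inverse j = subst (λ z → invFact j * ℕ→ℚ z ≡ 1ℚ) (ℕₚ.suc-pred (fact j) {{ℕ.>-nonZero (1≤fact j)}})
  (inv-inverse (ℕ.pred (fact j)))

invFact-suc : ∀ j → ℕ→ℚ (suc j) * invFact (suc j) ≡ invFact j
invFact-suc j = begin
  s * f'                         ≡⟨ Qₚ.*-identityʳ _ ⟨
  s * f' * 1ℚ                    ≡⟨ cong (s * f' *_) (invFact-inverse j) ⟨
  s * f' * (f * k)               ≡⟨ solve 4 (λ s f' f k → s :* f' :* (f :* k) := f' :* (s :* k) :* f) refl s f' f k ⟩
  f' * (s * k) * f               ≡⟨ cong (λ z → f' * z * f) (ℕ→ℚ-* (suc j) (fact j)) ⟨
  f' * ℕ→ℚ (fact (suc j)) * f    ≡⟨ cong (_* f) (invFact-inverse (suc j)) ⟩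
  1ℚ * f                         ≡⟨ Qₚ.*-identityˡ f ⟩
  f                              ∎
  where
  open ≡-Reasoning
  s  = ℕ→ℚ (suc j)
  f  = invFact j
  f' = invFact (suc j)
  k  = ℕ→ℚ (fact j)

module _ {y w : ℚ} (0≤y : 0ℚ Q.≤ y) (0≤w : 0ℚ Q.≤ w) where

  -- These are the first two terms of the binomial expansion of the right-hand side; divided by (j +
  -- 1)! they give `term-step`.
  power-step : ∀ j → y ^ℚ suc j + ℕ→ℚ (suc j) * (w * y ^ℚ j) Q.≤ (y + w) ^ℚ suc j
  power-step zero    = Qₚ.≤-reflexive (solve 2 (λ y w → y :* con 1ℚ :+ con 1ℚ :* (w :* con 1ℚ) := (y :+ w) :* con 1ℚ) refl y w)
  power-step (suc j) = begin
    y * yʲ⁺¹ + ℕ→ℚ (suc (suc j)) * (w * yʲ⁺¹)          ≡⟨ cong (λ z → y * yʲ⁺¹ + z * (w * yʲ⁺¹)) (ℕ→ℚ-+ 1 (suc j)) ⟩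
    y * yʲ⁺¹ + (1ℚ + s) * (w * yʲ⁺¹)                   ≤⟨ ≤-by-difference (s * (w * (w * y ^ℚ j))) (0≤* (0≤ℕ→ℚ (suc j)) (0≤* 0≤w (0≤* 0≤w (0≤^ 0≤y j))))
      (solve 4 (λ y w a s → (y :* (y :* a) :+ (con 1ℚ :+ s) :* (w :* (y :* a))) :+ s :* (w :* (w :* a))
                          := (y :+ w) :* (y :* a :+ s :* (w :* a))) refl y w (y ^ℚ j) s) ⟩
    (y + w) * (yʲ⁺¹ + s * (w * y ^ℚ j))                ≤⟨ *-monoˡ (0≤+ 0≤y 0≤w) (power-step j) ⟩
    (y + w) ^ℚ suc (suc j)                             ∎
    where
    open Qₚ.≤-Reasoning
    yʲ⁺¹ = y ^ℚ suc j
    s = ℕ→ℚ (suc j)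

  term-step : ∀ j → term y (suc j) + w * term y j Q.≤ term (y + w) (suc j)
  term-step j = begin
    a * f' + w * (y ^ℚ j * f)                    ≡⟨ cong (λ z → a * f' + w * (y ^ℚ j * z)) (invFact-suc j) ⟨
    a * f' + w * (y ^ℚ j * (s * f'))             ≡⟨ solve 5 (λ a f' w b s → a :* f' :+ w :* (b :* (s :* f')) := (a :+ s :* (w :* b)) :* f') refl a f' w (y ^ℚ j) s ⟩
    (a + s * (w * y ^ℚ j)) * f'                  ≤⟨ *-monoʳ (0≤inv (ℕ.pred (fact (suc j)))) (power-step j) ⟩
    (y + w) ^ℚ suc j * f'                        ∎
    where
    open Qₚ.≤-Reasoning
    a  = y ^ℚ suc j
    s  = ℕ→ℚ (suc j)
    f  = invFact j
    f' = invFact (suc j)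

  expPartial-step : ∀ K → expPartial y (suc K) + w * expPartial y K Q.≤ expPartial (y + w) (suc K)
  expPartial-step zero    = Qₚ.≤-reflexive (trans (cong (expPartial y 1 +_) (Qₚ.*-zeroʳ w)) (Qₚ.+-identityʳ (expPartial y 1)))
  expPartial-step (suc K) = begin
    (e + t + t') + w * (e + t)        ≡⟨ solve 4 (λ e t t' w → (e :+ t :+ t') :+ w :* (e :+ t) := (e :+ t :+ w :* e) :+ (t' :+ w :* t)) refl e t t' w ⟩
    (e + t + w * e) + (t' + w * t)    ≤⟨ Qₚ.+-mono-≤ (expPartial-step K) (term-step K) ⟩
    expPartial (y + w) (suc (suc K))  ∎
    where
    open Qₚ.≤-Reasoning
    e  = expPartial y K
    t  = term y K
    t' = term y (suc K)

  -- A finite form of e^(y + w) ≥ (1 + w) e^y: one more summand on the right makes up for the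
  -- truncation.
  expPartial-shift : ∀ K → (1ℚ + w) * expPartial y K Q.≤ expPartial (y + w) (suc K)
  expPartial-shift K = Qₚ.≤-trans
    (≤-by-difference (term y K) (0≤* (0≤^ 0≤y K) (0≤inv (ℕ.pred (fact K))))
      (solve 3 (λ w e t → (con 1ℚ :+ w) :* e :+ t := e :+ t :+ w :* e) refl w (expPartial y K) (term y K)))
    (expPartial-step K)

-- A finite form of (1 + w)^m ≤ e^(m w), obtained by m shifts. Since `LnLe` asks for a partial sum,
-- this turns bounds on powers into bounds on logarithms.
power≤expPartial : ∀ {w} → 0ℚ Q.≤ w → ∀ m → (1ℚ + w) ^ℚ m Q.≤ expPartial (ℕ→ℚ m * w) (suc m)
power≤expPartial 0≤w zero    = Qₚ.≤-refl
power≤expPartial {w} 0≤w (suc m) = begin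
  (1ℚ + w) * (1ℚ + w) ^ℚ m                          ≤⟨ *-monoˡ (0≤1+ 0≤w) (power≤expPartial 0≤w m) ⟩
  (1ℚ + w) * expPartial (ℕ→ℚ m * w) (suc m)         ≤⟨ expPartial-shift (0≤* (0≤ℕ→ℚ m) 0≤w) 0≤w (suc m) ⟩
  expPartial (ℕ→ℚ m * w + w) (suc (suc m))          ≡⟨ cong (λ z → expPartial z (suc (suc m))) eq ⟩
  expPartial (ℕ→ℚ (suc m) * w) (suc (suc m))        ∎
  where
  open Qₚ.≤-Reasoning
  eq : ℕ→ℚ m * w + w ≡ ℕ→ℚ (suc m) * w
  eq = trans (solve 2 (λ m w → m :* w :+ w := (con 1ℚ :+ m) :* w) refl (ℕ→ℚ m) w) (cong (_* w) (≡-sym (ℕ→ℚ-+ 1 m)))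

-- Growth of powers

-- Bernoulli's inequality, applied to both halves of the exponent 2 k, gives (1 + η)^(2 k) ≥ (k
-- η)^2, which beats 2 k B for large k. Beyond that, each step multiplies the right side by 1 + η
-- and the left side by at most that much.
linear≤exponential : ∀ {η} → 0ℚ < η → ∀ {B} → 0ℚ Q.≤ B →
  Σ ℕ λ L₀ → ∀ L → L₀ ≤ L → B * ℕ→ℚ L Q.≤ (1ℚ + η) ^ℚ L
linear≤exponential {η} 0<η {B} 0≤B = k ℕ.+ k , λ L L₀≤L →
  subst (λ z → B * ℕ→ℚ z Q.≤ (1ℚ + η) ^ℚ z) (ℕₚ.m∸n+n≡m L₀≤L) (growth (L ∸ (k ℕ.+ k)))
  where
  open Qₚ.≤-Reasoning
  0≤η = Qₚ.<⇒≤ 0<η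
  ζ = proj₁ (reciprocal 0<η)
  0≤ζ = Qₚ.<⇒≤ (proj₁ (proj₂ (reciprocal 0<η)))
  ηζ≡1 = proj₂ (proj₂ (reciprocal 0<η))
  -- The two summands, with ζ = 1 / η, ensure k η ≥ 1 and k η^2 ≥ 2 B respectively.
  bound = ζ + (B + B) * (ζ * ζ)
  k = proj₁ (archimedean bound)
  bound≤k = proj₂ (archimedean bound)
  1≤kη : 1ℚ Q.≤ ℕ→ℚ k * η
  1≤kη = begin
    1ℚ           ≡⟨ ηζ≡1 ⟨
    η * ζ        ≤⟨ *-monoˡ 0≤η (Qₚ.≤-trans (≤-by-difference _ (0≤* (0≤+ 0≤B 0≤B) (0≤* 0≤ζ 0≤ζ)) refl) bound≤k) ⟩
    η * ℕ→ℚ k    ≡⟨ Qₚ.*-comm η (ℕ→ℚ k) ⟩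
    ℕ→ℚ k * η    ∎
  2B≤kη² : B + B Q.≤ ℕ→ℚ k * (η * η)
  2B≤kη² = begin
    B + B                                   ≡⟨ Qₚ.*-identityʳ _ ⟨
    (B + B) * (1ℚ * 1ℚ)                     ≡⟨ cong (λ z → (B + B) * (z * z)) ηζ≡1 ⟨
    (B + B) * (η * ζ * (η * ζ))             ≡⟨ solve 3 (λ B η ζ → (B :+ B) :* (η :* ζ :* (η :* ζ)) := (B :+ B) :* (ζ :* ζ) :* (η :* η)) refl B η ζ ⟩
    (B + B) * (ζ * ζ) * (η * η)             ≤⟨ *-monoʳ {η * η} {(B + B) * (ζ * ζ)} (0≤* 0≤η 0≤η) (Qₚ.≤-trans (≤-by-difference ζ 0≤ζ (Qₚ.+-comm ((B + B) * (ζ * ζ)) ζ)) bound≤k) ⟩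
    ℕ→ℚ k * (η * η)                         ∎
  kη≤ : ℕ→ℚ k * η Q.≤ (1ℚ + η) ^ℚ k
  kη≤ = Qₚ.≤-trans (≤-by-difference 1ℚ 0≤1 (Qₚ.+-comm (ℕ→ℚ k * η) 1ℚ)) (bernoulli 0≤η k)
  growth : ∀ j → B * ℕ→ℚ (j ℕ.+ (k ℕ.+ k)) Q.≤ (1ℚ + η) ^ℚ (j ℕ.+ (k ℕ.+ k))
  growth zero = begin
    B * ℕ→ℚ (k ℕ.+ k)               ≡⟨ cong (B *_) (ℕ→ℚ-+ k k) ⟩
    B * (κ + κ)                     ≡⟨ solve 2 (λ B κ → B :* (κ :+ κ) := κ :* (B :+ B)) refl B κ ⟩
    κ * (B + B)                     ≤⟨ *-monoˡ (0≤ℕ→ℚ k) 2B≤kη² ⟩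
    κ * (κ * (η * η))               ≡⟨ solve 2 (λ κ η → κ :* (κ :* (η :* η)) := κ :* η :* (κ :* η)) refl κ η ⟩
    κ * η * (κ * η)                 ≤⟨ *-mono (0≤* (0≤ℕ→ℚ k) 0≤η) (0≤^ (0≤1+ 0≤η) k) kη≤ kη≤ ⟩
    (1ℚ + η) ^ℚ k * (1ℚ + η) ^ℚ k   ≡⟨ ^-+ (1ℚ + η) k k ⟨
    (1ℚ + η) ^ℚ (k ℕ.+ k)           ∎
    where κ = ℕ→ℚ k
  growth (suc j) = begin
    B * ℕ→ℚ (suc ℓ)                 ≡⟨ cong (B *_) (ℕ→ℚ-+ 1 ℓ) ⟩
    B * (1ℚ + ℕ→ℚ ℓ)                ≤⟨ *-monoˡ 0≤B (Qₚ.+-monoˡ-≤ (ℕ→ℚ ℓ) (Qₚ.≤-trans 1≤kη (*-monoʳ 0≤η (ℕ→ℚ-mono k≤ℓ)))) ⟩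
    B * (ℕ→ℚ ℓ * η + ℕ→ℚ ℓ)         ≡⟨ solve 3 (λ B ℓ η → B :* (ℓ :* η :+ ℓ) := (con 1ℚ :+ η) :* (B :* ℓ)) refl B (ℕ→ℚ ℓ) η ⟩
    (1ℚ + η) * (B * ℕ→ℚ ℓ)          ≤⟨ *-monoˡ (0≤1+ 0≤η) (growth j) ⟩
    (1ℚ + η) ^ℚ suc ℓ               ∎
    where
    ℓ = j ℕ.+ (k ℕ.+ k)
    k≤ℓ : k ≤ ℓ
    k≤ℓ = ℕₚ.≤-trans (ℕₚ.m≤m+n k k) (ℕₚ.m≤n+m (k ℕ.+ k) j)

module _ (w : ℚ) (0≤w : 0ℚ Q.≤ w) where

  -- A converse to Bernoulli's inequality: as long as 2 k w ≤ 1, the quadratic term in the induction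
  -- step is at most w.
  power≤1+2k : ∀ k → ℕ→ℚ (k ℕ.+ k) * w Q.≤ 1ℚ → (1ℚ + w) ^ℚ k Q.≤ 1ℚ + ℕ→ℚ (k ℕ.+ k) * w
  power≤1+2k zero    _   = Qₚ.≤-reflexive (≡-sym (trans (cong (1ℚ +_) (Qₚ.*-zeroˡ w)) (Qₚ.+-identityʳ 1ℚ)))
  power≤1+2k (suc k) small = begin
    (1ℚ + w) * (1ℚ + w) ^ℚ k          ≤⟨ *-monoˡ (0≤1+ 0≤w) (power≤1+2k k small′) ⟩
    (1ℚ + w) * (1ℚ + κ * w)           ≡⟨ solve 2 (λ w κ → (con 1ℚ :+ w) :* (con 1ℚ :+ κ :* w) := con 1ℚ :+ w :+ κ :* w :+ κ :* w :* w) refl w κ ⟩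
    1ℚ + w + κ * w + κ * w * w        ≤⟨ Qₚ.+-monoʳ-≤ (1ℚ + w + κ * w) (*-monoʳ 0≤w small′) ⟩
    1ℚ + w + κ * w + 1ℚ * w           ≡⟨ solve 2 (λ w κ → con 1ℚ :+ w :+ κ :* w :+ con 1ℚ :* w := con 1ℚ :+ (con 1ℚ :+ con 1ℚ :+ κ) :* w) refl w κ ⟩
    1ℚ + (1ℚ + 1ℚ + κ) * w            ≡⟨ cong (λ z → 1ℚ + z * w) split ⟨
    1ℚ + ℕ→ℚ (suc k ℕ.+ suc k) * w    ∎
    where
    open Qₚ.≤-Reasoning
    κ = ℕ→ℚ (k ℕ.+ k)
    split : ℕ→ℚ (suc k ℕ.+ suc k) ≡ 1ℚ + 1ℚ + κ
    split = trans (cong ℕ→ℚ (cong suc (ℕₚ.+-suc k k))) (ℕ→ℚ-+ 2 (k ℕ.+ k))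
    small′ : κ * w Q.≤ 1ℚ
    small′ = Qₚ.≤-trans (*-monoʳ 0≤w (ℕ→ℚ-mono (ℕₚ.+-mono-≤ (ℕₚ.n≤1+n k) (ℕₚ.n≤1+n k)))) small

-- With w = 1 / n and k the lower half of n = m + 1, we have n ≤ k + (k + 1), and both (1 + w)^k and
-- 1 + w are at most 2.
[1+1/n]^n≤8 : ∀ m → (1ℚ + inv m) ^ℚ suc m Q.≤ ℕ→ℚ 8
[1+1/n]^n≤8 m = begin
  (1ℚ + w) ^ℚ suc m                            ≤⟨ ^-monoʳ (1≤1+ (0≤inv m)) (ℕₚ.≤-trans (ℕₚ.≤-reflexive (≡-sym (ℕₚ.⌊n/2⌋+⌈n/2⌉≡n (suc m)))) (ℕₚ.+-monoʳ-≤ k ceil≤)) ⟩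
  (1ℚ + w) ^ℚ (k ℕ.+ suc k)                    ≡⟨ ^-+ (1ℚ + w) k (suc k) ⟩
  (1ℚ + w) ^ℚ k * ((1ℚ + w) * (1ℚ + w) ^ℚ k)   ≤⟨ *-mono (0≤^ 0≤q k) (0≤ℕ→ℚ 4) half (*-mono 0≤q (0≤ℕ→ℚ 2) q≤2 half) ⟩
  ℕ→ℚ 2 * (ℕ→ℚ 2 * ℕ→ℚ 2)                      ≡⟨⟩
  ℕ→ℚ 8                                        ∎
  where
  open Qₚ.≤-Reasoning
  w = inv m
  k = ℕ.⌊ suc m /2⌋
  0≤q = 0≤1+ (0≤inv m)
  ceil≤ : ℕ.⌈ suc m /2⌉ ≤ suc k
  ceil≤ = s≤s (ℕₚ.⌊n/2⌋-mono (ℕₚ.n≤1+n m))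
  w*n≡1 : ℕ→ℚ (suc m) * w ≡ 1ℚ
  w*n≡1 = trans (Qₚ.*-comm (ℕ→ℚ (suc m)) w) (inv-inverse m)
  small : ℕ→ℚ (k ℕ.+ k) * w Q.≤ 1ℚ
  small = subst (ℕ→ℚ (k ℕ.+ k) * w Q.≤_) w*n≡1 (*-monoʳ (0≤inv m) (ℕ→ℚ-mono
    (ℕₚ.≤-trans (ℕₚ.+-monoʳ-≤ k (ℕₚ.⌊n/2⌋≤⌈n/2⌉ (suc m))) (ℕₚ.≤-reflexive (ℕₚ.⌊n/2⌋+⌈n/2⌉≡n (suc m))))))
  half : (1ℚ + w) ^ℚ k Q.≤ ℕ→ℚ 2
  half = Qₚ.≤-trans (power≤1+2k w (0≤inv m) k small) (Qₚ.+-monoʳ-≤ 1ℚ small)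
  q≤2 : 1ℚ + w Q.≤ ℕ→ℚ 2
  q≤2 = Qₚ.+-monoʳ-≤ 1ℚ (subst (Q._≤ 1ℚ) (Qₚ.*-identityˡ w) (subst (1ℚ * w Q.≤_) w*n≡1 (*-monoʳ (0≤inv m) (ℕ→ℚ-mono {1} {suc m} (s≤s z≤n)))))

-- Bernoulli's inequality replaces 1 + Y / n by (1 + 1 / n)^Y, which leads back to the case y = 1.
-- The bound does not depend on n.
[1+y/n]^n≤8^Y : ∀ {y} Y → 0ℚ Q.≤ y → y Q.≤ ℕ→ℚ Y → ∀ m → (1ℚ + y * inv m) ^ℚ suc m Q.≤ ℕ→ℚ 8 ^ℚ Y
[1+y/n]^n≤8^Y {y} Y 0≤y y≤Y m = begin
  (1ℚ + y * inv m) ^ℚ suc m           ≤⟨ ^-mono (0≤1+ (0≤* 0≤y (0≤inv m))) (Qₚ.+-monoʳ-≤ 1ℚ (*-monoʳ (0≤inv m) y≤Y)) (suc m) ⟩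
  (1ℚ + ℕ→ℚ Y * inv m) ^ℚ suc m       ≤⟨ ^-mono (0≤1+ (0≤* (0≤ℕ→ℚ Y) (0≤inv m))) (bernoulli (0≤inv m) Y) (suc m) ⟩
  ((1ℚ + inv m) ^ℚ Y) ^ℚ suc m        ≡⟨ ^-* (1ℚ + inv m) Y (suc m) ⟨
  (1ℚ + inv m) ^ℚ (Y ℕ.* suc m)       ≡⟨ cong ((1ℚ + inv m) ^ℚ_) (ℕₚ.*-comm Y (suc m)) ⟩
  (1ℚ + inv m) ^ℚ (suc m ℕ.* Y)       ≡⟨ ^-* (1ℚ + inv m) (suc m) Y ⟩
  ((1ℚ + inv m) ^ℚ suc m) ^ℚ Y        ≤⟨ ^-mono (0≤^ (0≤1+ (0≤inv m)) (suc m)) ([1+1/n]^n≤8 m) Y ⟩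
  ℕ→ℚ 8 ^ℚ Y                          ∎
  where open Qₚ.≤-Reasoning

-- The number of vertices to protect

leastExponent : ∀ r b M → b Q.≤ r ^ℚ M → 1ℚ < b →
  Σ ℕ λ L → b Q.≤ r ^ℚ suc L × r ^ℚ L Q.≤ b
leastExponent r b zero    b≤ 1<b = ⊥-elim (Qₚ.<-irrefl refl (Qₚ.<-≤-trans 1<b b≤))
leastExponent r b (suc M) b≤ 1<b with b Q.≤? r ^ℚ M
... | yes b≤′ = leastExponent r b M b≤′ 1<b
... | no  b≰  = M , b≤ , Qₚ.<⇒≤ (Qₚ.≰⇒> b≰)

ℕ→ℚ-cancel-≤ : ∀ {m n} → ℕ→ℚ m Q.≤ ℕ→ℚ n → m ≤ n
ℕ→ℚ-cancel-≤ {m} {n} ιm≤ιn = ℕₚ.≮⇒≥ λ n<m →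
  Qₚ.<-irrefl refl (Qₚ.<-≤-trans (ℕ→ℚ-<-suc n) (Qₚ.≤-trans (ℕ→ℚ-mono n<m) ιm≤ιn))
  where
  ℕ→ℚ-<-suc : ∀ k → ℕ→ℚ k < ℕ→ℚ (suc k)
  ℕ→ℚ-<-suc k = subst₂ _<_ (Qₚ.+-identityˡ (ℕ→ℚ k)) (≡-sym (ℕ→ℚ-+ 1 k)) (Qₚ.+-monoˡ-< (ℕ→ℚ k) (Qₚ.positive⁻¹ 1ℚ))


*-identity-swap : ∀ {a b} c → a * b ≡ 1ℚ → a * (b * c) ≡ c
*-identity-swap {a} {b} c ab≡1 = trans (≡-sym (Qₚ.*-assoc a b c)) (trans (cong (_* c) ab≡1) (Qₚ.*-identityˡ c))

-- L is the exponent at which r^L passes b. The overshoot is at most one factor r ≤ R, and L ≥ L₀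
-- since R^L₀ is still below b.
crossing : ∀ {y r R b} L₀ → 0ℚ < y → 1ℚ + y Q.≤ r → r Q.≤ R → R ^ℚ L₀ < b → 1ℚ < b →
  Σ ℕ λ L → L₀ ≤ L × b Q.≤ r ^ℚ L × r ^ℚ L Q.≤ R * b
crossing {y} {r} {R} {b} L₀ 0<y 1+y≤r r≤R R^L₀<b 1<b =
  suc (proj₁ least) , L₀≤L , proj₁ (proj₂ least) , *-mono {r} {R} {r ^ℚ proj₁ least} {b} 0≤r 0≤b r≤R (proj₂ (proj₂ least))
  where
  open Qₚ.≤-Reasoning
  0≤y = Qₚ.<⇒≤ 0<y
  1≤r : 1ℚ Q.≤ r
  1≤r = Qₚ.≤-trans (1≤1+ {y} 0≤y) 1+y≤r
  0≤r : 0ℚ Q.≤ r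
  0≤r = Qₚ.≤-trans 0≤1 1≤r
  0≤b : 0ℚ Q.≤ b
  0≤b = Qₚ.≤-trans 0≤1 (Qₚ.<⇒≤ 1<b)
  y⁻¹ = proj₁ (reciprocal 0<y)
  -- M ≥ b / y suffices for (1 + y)^M ≥ b by Bernoulli's inequality, which gives the downward search
  -- a starting point.
  M = proj₁ (archimedean (y⁻¹ * b))
  b≤r^M : b Q.≤ r ^ℚ M
  b≤r^M = begin
    b                       ≡⟨ *-identity-swap {y} {y⁻¹} b (proj₂ (proj₂ (reciprocal 0<y))) ⟨
    y * (y⁻¹ * b)           ≤⟨ *-monoˡ 0≤y (proj₂ (archimedean (y⁻¹ * b))) ⟩
    y * ℕ→ℚ M               ≡⟨ Qₚ.*-comm y (ℕ→ℚ M) ⟩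
    ℕ→ℚ M * y               ≤⟨ ≤-by-difference 1ℚ 0≤1 (Qₚ.+-comm (ℕ→ℚ M * y) 1ℚ) ⟩
    1ℚ + ℕ→ℚ M * y          ≤⟨ bernoulli 0≤y M ⟩
    (1ℚ + y) ^ℚ M           ≤⟨ ^-mono {1ℚ + y} {r} (0≤1+ {y} 0≤y) 1+y≤r M ⟩
    r ^ℚ M                  ∎
  least = leastExponent r b M b≤r^M 1<b
  L₀≤L : L₀ ≤ suc (proj₁ least)
  L₀≤L = ℕₚ.≮⇒≥ λ L<L₀ → Qₚ.<-irrefl refl (Qₚ.<-≤-trans R^L₀<b (Qₚ.≤-trans (proj₁ (proj₂ least))
    (Qₚ.≤-trans (^-mono {r} {R} 0≤r r≤R (suc (proj₁ least)))
                (^-monoʳ {R} (Qₚ.≤-trans 1≤r r≤R) (ℕₚ.<⇒≤ L<L₀)))))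

module _ {n : ℕ} {w : ℚ} (0≤w : 0ℚ Q.≤ w) (n*w≡1 : ℕ→ℚ n * w ≡ 1ℚ) where

  n*zw≡z : ∀ z → ℕ→ℚ n * (z * w) ≡ z
  n*zw≡z z = begin
    ℕ→ℚ n * (z * w)      ≡⟨ solve 3 (λ n z w → n :* (z :* w) := z :* (n :* w)) refl (ℕ→ℚ n) z w ⟩
    z * (ℕ→ℚ n * w)      ≡⟨ cong (z *_) n*w≡1 ⟩
    z * 1ℚ               ≡⟨ Qₚ.*-identityʳ z ⟩
    z                    ∎
    where open ≡-Reasoning

  1+z≤[1+zw]^n : ∀ z → 0ℚ Q.≤ z → 1ℚ + z Q.≤ (1ℚ + z * w) ^ℚ n
  1+z≤[1+zw]^n z 0≤z = subst (λ u → 1ℚ + u Q.≤ (1ℚ + z * w) ^ℚ n) (n*zw≡z z) (bernoulli {z * w} (0≤* 0≤z 0≤w) n)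

  -- With w = 1 / n, (1 + x w) (1 + η w) ≤ 1 + (x + η + x η) w and 1 + η ≤ (1 + η w)^n. The gain (1
  -- + η)^L will absorb the factor L in the failure bound.
  power-gap : w Q.≤ 1ℚ → ∀ {x η} → 0ℚ Q.≤ x → 0ℚ Q.≤ η → ∀ L →
    (1ℚ + x * w) ^ℚ (n ℕ.* L) * (1ℚ + η) ^ℚ L Q.≤ ((1ℚ + (x + η + x * η) * w) ^ℚ n) ^ℚ L
  power-gap w≤1 {x} {η} 0≤x 0≤η L = begin
    q ^ℚ (n ℕ.* L) * (1ℚ + η) ^ℚ L           ≡⟨ cong (_* (1ℚ + η) ^ℚ L) (^-* q n L) ⟩
    (q ^ℚ n) ^ℚ L * (1ℚ + η) ^ℚ L            ≡⟨ ^-distrib-* (q ^ℚ n) (1ℚ + η) L ⟨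
    (q ^ℚ n * (1ℚ + η)) ^ℚ L                 ≤⟨ ^-mono {q ^ℚ n * (1ℚ + η)} {p ^ℚ n} (0≤* (0≤^ 0≤q n) (0≤1+ {η} 0≤η)) base L ⟩
    (p ^ℚ n) ^ℚ L                            ∎
    where
    open Qₚ.≤-Reasoning
    p = 1ℚ + (x + η + x * η) * w
    q = 1ℚ + x * w
    0≤q : 0ℚ Q.≤ q
    0≤q = 0≤1+ {x * w} (0≤* 0≤x 0≤w)
    0≤1+ηw : 0ℚ Q.≤ 1ℚ + η * w
    0≤1+ηw = 0≤1+ {η * w} (0≤* 0≤η 0≤w)
    factor : q * (1ℚ + η * w) Q.≤ p
    factor = begin
      (1ℚ + x * w) * (1ℚ + η * w)              ≡⟨ solve 3 (λ x η w → (con 1ℚ :+ x :* w) :* (con 1ℚ :+ η :* w) := con 1ℚ :+ (x :+ η) :* w :+ x :* η :* w :* w) refl x η w ⟩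
      1ℚ + (x + η) * w + x * η * w * w         ≤⟨ Qₚ.+-monoʳ-≤ (1ℚ + (x + η) * w) (*-monoˡ {x * η * w} (0≤* (0≤* 0≤x 0≤η) 0≤w) w≤1) ⟩
      1ℚ + (x + η) * w + x * η * w * 1ℚ        ≡⟨ solve 3 (λ x η w → con 1ℚ :+ (x :+ η) :* w :+ x :* η :* w :* con 1ℚ := con 1ℚ :+ (x :+ η :+ x :* η) :* w) refl x η w ⟩
      1ℚ + (x + η + x * η) * w                 ∎
    base : q ^ℚ n * (1ℚ + η) Q.≤ p ^ℚ n
    base = begin
      q ^ℚ n * (1ℚ + η)                ≤⟨ *-monoˡ {q ^ℚ n} (0≤^ 0≤q n) (1+z≤[1+zw]^n η 0≤η) ⟩
      q ^ℚ n * (1ℚ + η * w) ^ℚ n       ≡⟨ ^-distrib-* q (1ℚ + η * w) n ⟨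
      (q * (1ℚ + η * w)) ^ℚ n          ≤⟨ ^-mono {q * (1ℚ + η * w)} {p} (0≤* 0≤q 0≤1+ηw) factor n ⟩
      p ^ℚ n                           ∎

  power⇒LnLe : ∀ {y} → 0ℚ Q.≤ y → ∀ L → ℕ→ℚ n Q.≤ ((1ℚ + y * w) ^ℚ n) ^ℚ L → LnLe n (ℕ→ℚ L * y)
  power⇒LnLe {y} 0≤y L n≤ = suc (n ℕ.* L) , (begin
    ℕ→ℚ n                                                       ≤⟨ n≤ ⟩
    ((1ℚ + y * w) ^ℚ n) ^ℚ L                                    ≡⟨ ^-* (1ℚ + y * w) n L ⟨
    (1ℚ + y * w) ^ℚ (n ℕ.* L)                                   ≤⟨ power≤expPartial {y * w} (0≤* 0≤y 0≤w) (n ℕ.* L) ⟩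
    expPartial (ℕ→ℚ (n ℕ.* L) * (y * w)) (suc (n ℕ.* L))        ≡⟨ cong (λ z → expPartial z (suc (n ℕ.* L))) eq ⟩
    expPartial (ℕ→ℚ L * y) (suc (n ℕ.* L))                      ∎)
    where
    open Qₚ.≤-Reasoning
    eq : ℕ→ℚ (n ℕ.* L) * (y * w) ≡ ℕ→ℚ L * y
    eq = trans (cong (_* (y * w)) (ℕ→ℚ-* n L))
      (trans (solve 4 (λ n l y w → n :* l :* (y :* w) := l :* (n :* (y :* w))) refl (ℕ→ℚ n) (ℕ→ℚ L) y w)
             (cong (ℕ→ℚ L *_) (n*zw≡z y)))

0<* : ∀ {p q} → 0ℚ < p → 0ℚ < q → 0ℚ < p * q
0<* {p} {q} 0<p 0<q = Qₚ.positive⁻¹ (p * q) {{Qₚ.pos*pos⇒pos p {{Q.positive 0<p}} q {{Q.positive 0<q}}}}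

0<difference : ∀ {x y} → x < y → 0ℚ < y - x
0<difference {x} {y} x<y = subst (_< y - x) (Qₚ.+-inverseʳ x) (Qₚ.+-monoˡ-< (- x) x<y)

-- The solution of (1 + x) (1 + η) = 1 + y is η = (y - x) / (1 + x).
relativeGap : ∀ {x y} → 0ℚ Q.≤ x → x < y → Σ ℚ λ η → 0ℚ < η × x + η + x * η ≡ y
relativeGap {x} {y} 0≤x x<y = η , 0<* (0<difference x<y) (proj₁ (proj₂ (reciprocal 0<1+x))) , (begin
  x + η + x * η                    ≡⟨ solve 3 (λ x y ξ → x :+ (y :- x) :* ξ :+ x :* ((y :- x) :* ξ) := x :+ (y :- x) :* ((con 1ℚ :+ x) :* ξ)) refl x y ξ ⟩
  x + (y - x) * ((1ℚ + x) * ξ)     ≡⟨ cong (λ z → x + (y - x) * z) (proj₂ (proj₂ (reciprocal 0<1+x))) ⟩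
  x + (y - x) * 1ℚ                 ≡⟨ solve 2 (λ x y → x :+ (y :- x) :* con 1ℚ := y) refl x y ⟩
  y                                ∎)
  where
  open ≡-Reasoning
  0<1+x : 0ℚ < 1ℚ + x
  0<1+x = Qₚ.<-≤-trans (Qₚ.positive⁻¹ 1ℚ) (1≤1+ {x} 0≤x)
  ξ = proj₁ (reciprocal 0<1+x)
  η = (y - x) * ξ

scaled-bound : ∀ {δ δ⁻¹ l b} → 0ℚ Q.≤ δ → 0ℚ Q.≤ l → δ * δ⁻¹ ≡ 1ℚ → (1ℚ + δ⁻¹) * l Q.≤ b → l Q.≤ δ * b
scaled-bound {δ} {δ⁻¹} {l} {b} 0≤δ 0≤l δδ⁻¹≡1 ≤b = begin
  l                             ≤⟨ ≤-by-difference (δ * l) (0≤* 0≤δ 0≤l) refl ⟩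
  l + δ * l                     ≡⟨ solve 2 (λ δ l → l :+ δ :* l := (δ :+ con 1ℚ) :* l) refl δ l ⟩
  (δ + 1ℚ) * l                  ≡⟨ cong (λ z → (δ + z) * l) δδ⁻¹≡1 ⟨
  (δ + δ * δ⁻¹) * l             ≡⟨ solve 3 (λ δ d l → (δ :+ δ :* d) :* l := δ :* ((con 1ℚ :+ d) :* l)) refl δ δ⁻¹ l ⟩
  δ * ((1ℚ + δ⁻¹) * l)          ≤⟨ *-monoˡ {δ} 0≤δ ≤b ⟩
  δ * b                         ∎
  where open Qₚ.≤-Reasoning

-- In the application ρ = (1 + η)^L, A = (1 + x / n)^(n L), r = (1 + y / n)^(n L) and b = n. As ρ is
-- at least R l / ε, dividing A ρ ≤ R b by R / ε leaves the claim.
gap-bound : ∀ {R ε ε⁻¹ l A ρ r b} → 0ℚ < R → 0ℚ Q.≤ ε → 0ℚ Q.≤ A → ε * ε⁻¹ ≡ 1ℚ →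
  R * ε⁻¹ * l Q.≤ ρ → A * ρ Q.≤ r → r Q.≤ R * b → l * A Q.≤ ε * b
gap-bound {R} {ε} {ε⁻¹} {l} {A} {ρ} {r} {b} 0<R 0≤ε 0≤A εε⁻¹≡1 growth gap r≤Rb = begin
  l * A                    ≡⟨ *-identity-swap {ε} {ε⁻¹} (l * A) εε⁻¹≡1 ⟨
  ε * (ε⁻¹ * (l * A))      ≤⟨ *-monoˡ {ε} 0≤ε (*-cancelˡ {R} 0<R scaled) ⟩
  ε * b                    ∎
  where
  open Qₚ.≤-Reasoning
  scaled : R * (ε⁻¹ * (l * A)) Q.≤ R * b
  scaled = begin
    R * (ε⁻¹ * (l * A))    ≡⟨ solve 4 (λ R e l q → R :* (e :* (l :* q)) := q :* (R :* e :* l)) refl R ε⁻¹ l A ⟩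
    A * (R * ε⁻¹ * l)      ≤⟨ *-monoˡ {A} 0≤A growth ⟩
    A * ρ                  ≤⟨ gap ⟩
    r                      ≤⟨ r≤Rb ⟩
    R * b                  ∎

-- The requirements on L for n = m + 1. In the application y = 1 / c and δ = α - a: `L≤δn` leaves
-- the walker at least a n exits, `ln≤yL` says L ≥ c ln n, and `Lqᴺ≤εn` makes the Markov bound at
-- most ε.
record TargetSize (x y δ ε : ℚ) (m : ℕ) : Set where
  field
    L       : ℕ
    L≤n     : L ≤ suc m
    L≤δn    : ℕ→ℚ L Q.≤ δ * ℕ→ℚ (suc m)
    ln≤yL   : LnLe (suc m) (ℕ→ℚ L * y)
    Lqᴺ≤εn  : ℕ→ℚ L * (1ℚ + x * inv m) ^ℚ (suc m ℕ.* L) Q.≤ ε * ℕ→ℚ (suc m)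

module _ {x y η δ δ⁻¹ ε ε⁻¹ R : ℚ} (0≤x : 0ℚ Q.≤ x) (0≤η : 0ℚ Q.≤ η) (x+η+xη≡y : x + η + x * η ≡ y) (0<y : 0ℚ < y)
  (0≤δ : 0ℚ Q.≤ δ) (0≤δ⁻¹ : 0ℚ Q.≤ δ⁻¹) (δδ⁻¹≡1 : δ * δ⁻¹ ≡ 1ℚ) (0≤ε : 0ℚ Q.≤ ε) (εε⁻¹≡1 : ε * ε⁻¹ ≡ 1ℚ)
  (0<R : 0ℚ < R) (L₀ : ℕ)
  (growth₁ : ∀ L → L₀ ≤ L → R * ε⁻¹ * ℕ→ℚ L Q.≤ (1ℚ + η) ^ℚ L)
  (growth₂ : ∀ L → L₀ ≤ L → R * (1ℚ + δ⁻¹) * ℕ→ℚ L Q.≤ (1ℚ + y) ^ℚ L) where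

  module _ {n : ℕ} {w : ℚ} (0≤w : 0ℚ Q.≤ w) (w≤1 : w Q.≤ 1ℚ) (n*w≡1 : ℕ→ℚ n * w ≡ 1ℚ)
    (L : ℕ) (L₀≤L : L₀ ≤ L) (r^L≤Rn : ((1ℚ + y * w) ^ℚ n) ^ℚ L Q.≤ R * ℕ→ℚ n) where

    -- Since (1 + y)^L ≤ R n, the number L is at most logarithmic in n. The factor 1 + 1 / δ yields
    -- both L ≤ n and L ≤ δ n.
    [1+δ⁻¹]L≤n : (1ℚ + δ⁻¹) * ℕ→ℚ L Q.≤ ℕ→ℚ n
    [1+δ⁻¹]L≤n = *-cancelˡ {R} 0<R (begin
      R * ((1ℚ + δ⁻¹) * ℕ→ℚ L)      ≡⟨ Qₚ.*-assoc R (1ℚ + δ⁻¹) (ℕ→ℚ L) ⟨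
      R * (1ℚ + δ⁻¹) * ℕ→ℚ L        ≤⟨ growth₂ L L₀≤L ⟩
      (1ℚ + y) ^ℚ L                 ≤⟨ ^-mono {1ℚ + y} {(1ℚ + y * w) ^ℚ n} (0≤1+ {y} (Qₚ.<⇒≤ 0<y))
                                         (1+z≤[1+zw]^n {n} {w} 0≤w n*w≡1 y (Qₚ.<⇒≤ 0<y)) L ⟩
      ((1ℚ + y * w) ^ℚ n) ^ℚ L      ≤⟨ r^L≤Rn ⟩
      R * ℕ→ℚ n                     ∎)
      where open Qₚ.≤-Reasoning

    Lq^nL≤εn : ℕ→ℚ L * (1ℚ + x * w) ^ℚ (n ℕ.* L) Q.≤ ε * ℕ→ℚ n
    Lq^nL≤εn = gap-bound {R} {ε} {ε⁻¹} {ℕ→ℚ L} {(1ℚ + x * w) ^ℚ (n ℕ.* L)} {(1ℚ + η) ^ℚ L} {((1ℚ + y * w) ^ℚ n) ^ℚ L} {ℕ→ℚ n}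
      0<R 0≤ε (0≤^ {1ℚ + x * w} (0≤1+ {x * w} (0≤* 0≤x 0≤w)) (n ℕ.* L)) εε⁻¹≡1 (growth₁ L L₀≤L)
      (subst (λ z → (1ℚ + x * w) ^ℚ (n ℕ.* L) * (1ℚ + η) ^ℚ L Q.≤ ((1ℚ + z * w) ^ℚ n) ^ℚ L) x+η+xη≡y
        (power-gap {n} {w} 0≤w n*w≡1 w≤1 {x} {η} 0≤x 0≤η L))
      r^L≤Rn

    L≤n∧L≤δn : L ≤ n × ℕ→ℚ L Q.≤ δ * ℕ→ℚ n
    L≤n∧L≤δn =
        ℕ→ℚ-cancel-≤ (Qₚ.≤-trans (≤-by-difference (δ⁻¹ * ℕ→ℚ L) (0≤* 0≤δ⁻¹ (0≤ℕ→ℚ L))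
          (solve 2 (λ d l → l :+ d :* l := (con 1ℚ :+ d) :* l) refl δ⁻¹ (ℕ→ℚ L))) [1+δ⁻¹]L≤n)
      , scaled-bound {δ} {δ⁻¹} {ℕ→ℚ L} {ℕ→ℚ n} 0≤δ (0≤ℕ→ℚ L) δδ⁻¹≡1 [1+δ⁻¹]L≤n

  targetSize-beyond : ∀ m → 1ℚ < ℕ→ℚ (suc m) → R ^ℚ L₀ < ℕ→ℚ (suc m) → (1ℚ + y * inv m) ^ℚ suc m Q.≤ R → TargetSize x y δ ε m
  targetSize-beyond m 1<n R^L₀<n r≤R = record
    { L = L ; L≤n = proj₁ sizes ; L≤δn = proj₂ sizes
    ; ln≤yL = power⇒LnLe {suc m} {inv m} 0≤w n*w≡1 {y} 0≤y L (proj₁ (proj₂ (proj₂ cross)))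
    ; Lqᴺ≤εn = Lq^nL≤εn {suc m} {inv m} 0≤w w≤1 n*w≡1 L L₀≤L r^L≤Rn }
    where
    0≤y = Qₚ.<⇒≤ 0<y
    0≤w = 0≤inv m
    n*w≡1 : ℕ→ℚ (suc m) * inv m ≡ 1ℚ
    n*w≡1 = trans (Qₚ.*-comm (ℕ→ℚ (suc m)) (inv m)) (inv-inverse m)
    w≤1 : inv m Q.≤ 1ℚ
    w≤1 = subst₂ Q._≤_ (Qₚ.*-identityʳ (inv m)) (inv-inverse m) (*-monoˡ {inv m} 0≤w (ℕ→ℚ-mono {1} {suc m} (s≤s z≤n)))
    cross = crossing {y} {(1ℚ + y * inv m) ^ℚ suc m} {R} {ℕ→ℚ (suc m)} L₀ 0<y (1+z≤[1+zw]^n {suc m} {inv m} 0≤w n*w≡1 y 0≤y) r≤R R^L₀<n 1<n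
    L = proj₁ cross
    L₀≤L = proj₁ (proj₂ cross)
    r^L≤Rn = proj₂ (proj₂ (proj₂ cross))
    sizes = L≤n∧L≤δn {suc m} {inv m} 0≤w w≤1 n*w≡1 L L₀≤L r^L≤Rn

<suc-archimedean : ∀ {p n} → suc (proj₁ (archimedean p)) ≤ n → p < ℕ→ℚ n
<suc-archimedean {p} N<n = Qₚ.≤-<-trans (proj₂ (archimedean p)) (Qₚ.≰⇒> λ n≤N → ℕₚ.<⇒≱ N<n (ℕ→ℚ-cancel-≤ n≤N))

targetSize : ∀ {x y δ ε} → 0ℚ Q.≤ x → x < y → 0ℚ < δ → 0ℚ < ε → Σ ℕ λ N → ∀ m → N ≤ suc m → TargetSize x y δ ε m
targetSize {x} {y} {δ} {ε} 0≤x x<y 0<δ 0<ε =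
  -- This threshold is at least 2 and exceeds R^L₀, so n > 1 and n > R^L₀, as `crossing` demands.
  suc (suc (proj₁ (archimedean (R ^ℚ L₀)))) , λ m N≤n →
    targetSize-beyond {x} {y} {proj₁ gap} {δ} {proj₁ recδ} {ε} {proj₁ recε} {R} 0≤x (Qₚ.<⇒≤ (proj₁ (proj₂ gap))) (proj₂ (proj₂ gap)) 0<y
      (Qₚ.<⇒≤ 0<δ) 0≤δ⁻¹ (proj₂ (proj₂ recδ)) (Qₚ.<⇒≤ 0<ε) (proj₂ (proj₂ recε)) 0<R L₀
      (λ L L₀≤L → proj₂ growth₁ L (ℕₚ.≤-trans (ℕₚ.m≤m+n (proj₁ growth₁) (proj₁ growth₂)) L₀≤L))
      (λ L L₀≤L → proj₂ growth₂ L (ℕₚ.≤-trans (ℕₚ.m≤n+m (proj₁ growth₂) (proj₁ growth₁)) L₀≤L))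
      m
      (Qₚ.≰⇒> λ n≤1 → ℕₚ.<⇒≱ (ℕₚ.≤-trans (s≤s (s≤s z≤n)) N≤n) (ℕ→ℚ-cancel-≤ {suc m} {1} n≤1))
      (<suc-archimedean (ℕₚ.≤-trans (ℕₚ.n≤1+n _) N≤n))
      ([1+y/n]^n≤8^Y {y} Y (Qₚ.<⇒≤ 0<y) (proj₂ (archimedean y)) m)
  where
  0<y : 0ℚ < y
  0<y = Qₚ.≤-<-trans 0≤x x<y
  gap = relativeGap 0≤x x<y
  recδ = reciprocal 0<δ
  recε = reciprocal 0<ε
  0≤δ⁻¹ = Qₚ.<⇒≤ (proj₁ (proj₂ recδ))
  0≤ε⁻¹ = Qₚ.<⇒≤ (proj₁ (proj₂ recε))
  Y = proj₁ (archimedean y)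
  R = ℕ→ℚ 8 ^ℚ Y
  0<R : 0ℚ < R
  0<R = Qₚ.<-≤-trans (Qₚ.positive⁻¹ 1ℚ) (1≤^ {ℕ→ℚ 8} (ℕ→ℚ-mono {1} {8} (s≤s z≤n)) Y)
  growth₁ = linear≤exponential (proj₁ (proj₂ gap)) (0≤* {R} {proj₁ recε} (Qₚ.<⇒≤ 0<R) 0≤ε⁻¹)
  growth₂ = linear≤exponential 0<y (0≤* {R} {1ℚ + proj₁ recδ} (Qₚ.<⇒≤ 0<R) (0≤1+ {proj₁ recδ} 0≤δ⁻¹))
  L₀ = proj₁ growth₁ ℕ.+ proj₁ growth₂

-- Cardinalities of decidable subsets

∧⁻ : ∀ {a b} → T (a ∧ b) → T a × T b
∧⁻ = Equivalence.to T-∧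

∧⁺ : ∀ {a b} → T a → T b → T (a ∧ b)
∧⁺ ta tb = Equivalence.from T-∧ (ta , tb)

∨⁻ : ∀ {a b} → T (a ∨ b) → T a ⊎ T b
∨⁻ = Equivalence.to T-∨

∨⁺ : ∀ {a b} → T a ⊎ T b → T (a ∨ b)
∨⁺ = Equivalence.from T-∨

not⁻ : ∀ {a} → T (not a) → ¬ T a
not⁻ {false} _ ()

not⁺ : ∀ {a} → ¬ T a → T (not a)
not⁺ {false} _  = _
not⁺ {true}  ¬a = ⊥-elim (¬a _)

T⇒≡true : ∀ {a} → T a → a ≡ true
T⇒≡true = Equivalence.to T-≡

==⁻ : ∀ {n} {a b : Fin n} → T (a == b) → a ≡ b
==⁻ {a = a} {b} = toWitness {a? = a ≟ b}

==⁺ : ∀ {n} {a b : Fin n} → a ≡ b → T (a == b)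
==⁺ {a = a} {b} = fromWitness {a? = a ≟ b}

anyFin⁻ : ∀ {n} (p : Fin n → Bool) → T (any p (allFin n)) → ∃ λ x → T (p x)
anyFin⁻ {n} p t = let x , _ , px = find (any⁻ p (allFin n) t) in x , px

anyFin⁺ : ∀ {n} (p : Fin n → Bool) {x} → T (p x) → T (any p (allFin n))
anyFin⁺ p {x} px = any⁺ p (lose (∈-allFin x) px)

-- Cardinalities become sums of bits, so that inclusions and unions reduce to inequalities at each
-- vertex.
bit : Bool → ℕ
bit b = if b then 1 else 0

module _ {A : Set} where

  length-filterᵇ : ∀ (p : A → Bool) xs → length (filterᵇ p xs) ≡ sum (map (bit ∘ p) xs)
  length-filterᵇ p []       = refl
  length-filterᵇ p (x ∷ xs) with p x
  ... | true  = cong suc (length-filterᵇ p xs)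
  ... | false = length-filterᵇ p xs

  sum-mono : ∀ {f g : A → ℕ} → (∀ x → f x ≤ g x) → ∀ xs → sum (map f xs) ≤ sum (map g xs)
  sum-mono f≤g []       = z≤n
  sum-mono f≤g (x ∷ xs) = ℕₚ.+-mono-≤ (f≤g x) (sum-mono f≤g xs)

  sum-strict : ∀ {f g : A → ℕ} → (∀ x → f x ≤ g x) → ∀ {w xs} → w ∈ xs → f w ℕ.< g w → sum (map f xs) ℕ.< sum (map g xs)
  sum-strict f≤g {xs = x ∷ xs} (here refl) f<g = ℕₚ.+-mono-<-≤ f<g (sum-mono f≤g xs)
  sum-strict f≤g {xs = x ∷ xs} (there w∈)  f<g = ℕₚ.+-mono-≤-< (f≤g x) (sum-strict f≤g w∈ f<g)

  sum-+ : ∀ (f g : A → ℕ) xs → sum (map (λ x → f x ℕ.+ g x) xs) ≡ sum (map f xs) ℕ.+ sum (map g xs)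
  sum-+ f g []       = refl
  sum-+ f g (x ∷ xs) = trans (cong (f x ℕ.+ g x ℕ.+_) (sum-+ f g xs)) (interchange ℕₚ.+-commutativeSemigroup (f x) (g x) _ _)

  sum-* : ∀ k (f : A → ℕ) xs → sum (map (λ x → k ℕ.* f x) xs) ≡ k ℕ.* sum (map f xs)
  sum-* k f []       = ≡-sym (ℕₚ.*-zeroʳ k)
  sum-* k f (x ∷ xs) = trans (cong (k ℕ.* f x ℕ.+_) (sum-* k f xs)) (≡-sym (ℕₚ.*-distribˡ-+ k (f x) _))

  sum-const1 : ∀ (xs : List A) → sum (map (λ _ → 1) xs) ≡ length xs
  sum-const1 []       = refl
  sum-const1 (x ∷ xs) = cong suc (sum-const1 xs)

  -- Used to bound the number of exits to unvisited vertices by the number of all unvisited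
  -- vertices.
  length-filterᵇ-filterᵇ : ∀ (p q : A → Bool) xs → length (filterᵇ q (filterᵇ p xs)) ≤ length (filterᵇ q xs)
  length-filterᵇ-filterᵇ p q []       = z≤n
  length-filterᵇ-filterᵇ p q (x ∷ xs) with p x
  ... | true  with q x
  ...   | true  = s≤s (length-filterᵇ-filterᵇ p q xs)
  ...   | false = length-filterᵇ-filterᵇ p q xs
  length-filterᵇ-filterᵇ p q (x ∷ xs) | false with q x
  ...   | true  = ℕₚ.m≤n⇒m≤1+n (length-filterᵇ-filterᵇ p q xs)
  ...   | false = length-filterᵇ-filterᵇ p q xs

  unique-constant : ∀ {w : A} {xs} → Unique xs → (∀ {x} → x ∈ xs → x ≡ w) → length xs ≤ 1
  unique-constant {xs = []}         _ _ = z≤n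
  unique-constant {xs = _ ∷ []}     _ _ = ℕₚ.≤-refl
  unique-constant {xs = _ ∷ _ ∷ _} ((x≢y ∷ _) ∷ _) const =
    ⊥-elim (x≢y (trans (const (here refl)) (≡-sym (const (there (here refl))))))

bit-mono-⊎ : ∀ {a b c} → (T a → T b ⊎ T c) → bit a ≤ bit b ℕ.+ bit c
bit-mono-⊎ {false}                _ = z≤n
bit-mono-⊎ {true} {true}          _ = s≤s z≤n
bit-mono-⊎ {true} {false} {true}  _ = ℕₚ.≤-refl
bit-mono-⊎ {true} {false} {false} h = ⊥-elim ([ id , id ] (h _))

bit-mono : ∀ {a b} → (T a → T b) → bit a ≤ bit b
bit-mono {false}        _ = z≤n
bit-mono {true} {true}  _ = ℕₚ.≤-refl
bit-mono {true} {false} h = ⊥-elim (h _)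

bit-strict : ∀ {a b} → ¬ T a → T b → bit a ℕ.< bit b
bit-strict {false} {true} _ _ = ℕₚ.≤-refl
bit-strict {true}         h _ = ⊥-elim (h _)

bit-+-not : ∀ a → bit a ℕ.+ bit (not a) ≡ 1
bit-+-not false = refl
bit-+-not true  = refl

module _ {n : ℕ} where

  card≡sum : ∀ (p : Fin n → Bool) → card p ≡ sum (map (bit ∘ p) (allFin n))
  card≡sum p = length-filterᵇ p (allFin n)

  card-mono : ∀ {p q : Fin n → Bool} → (∀ x → T (p x) → T (q x)) → card p ≤ card q
  card-mono {p} {q} p⊆q = subst₂ _≤_ (≡-sym (card≡sum p)) (≡-sym (card≡sum q))
    (sum-mono (λ x → bit-mono (p⊆q x)) (allFin n))

  card-strict : ∀ {p q : Fin n → Bool} → (∀ x → T (p x) → T (q x)) → ∀ w → ¬ T (p w) → T (q w) → card p ℕ.< card q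
  card-strict {p} {q} p⊆q w ¬pw qw = subst₂ ℕ._<_ (≡-sym (card≡sum p)) (≡-sym (card≡sum q))
    (sum-strict (λ x → bit-mono (p⊆q x)) (∈-allFin w) (bit-strict ¬pw qw))

  card-∪ : ∀ {p q r : Fin n → Bool} → (∀ x → T (p x) → T (q x) ⊎ T (r x)) → card p ≤ card q ℕ.+ card r
  card-∪ {p} {q} {r} p⊆q∪r = begin
    card p                                                    ≡⟨ card≡sum p ⟩
    sum (map (bit ∘ p) (allFin n))                            ≤⟨ sum-mono (λ x → bit-mono-⊎ (p⊆q∪r x)) (allFin n) ⟩
    sum (map (λ x → bit (q x) ℕ.+ bit (r x)) (allFin n))      ≡⟨ sum-+ (bit ∘ q) (bit ∘ r) (allFin n) ⟩
    sum (map (bit ∘ q) (allFin n)) ℕ.+ sum (map (bit ∘ r) (allFin n)) ≡⟨ cong₂ ℕ._+_ (card≡sum q) (card≡sum r) ⟨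
    card q ℕ.+ card r                                         ∎
    where open ℕₚ.≤-Reasoning

  card-∁ : ∀ (p : Fin n → Bool) → card p ℕ.+ card (not ∘ p) ≡ n
  card-∁ p = begin
    card p ℕ.+ card (not ∘ p)                                          ≡⟨ cong₂ ℕ._+_ (card≡sum p) (card≡sum (not ∘ p)) ⟩
    sum (map (bit ∘ p) (allFin n)) ℕ.+ sum (map (bit ∘ not ∘ p) (allFin n)) ≡⟨ sum-+ (bit ∘ p) (bit ∘ not ∘ p) (allFin n) ⟨
    sum (map (λ x → bit (p x) ℕ.+ bit (not (p x))) (allFin n))         ≡⟨ sum-cong (allFin n) ⟩
    sum (map (λ _ → 1) (allFin n))                                     ≡⟨ sum-const1 (allFin n) ⟩
    length (allFin n)                                                  ≡⟨ length-tabulate id ⟩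
    n                                                                  ∎
    where
    open ≡-Reasoning
    sum-cong : ∀ xs → sum (map (λ x → bit (p x) ℕ.+ bit (not (p x))) xs) ≡ sum (map (λ _ → 1) xs)
    sum-cong []       = refl
    sum-cong (x ∷ xs) = cong₂ ℕ._+_ (bit-+-not (p x)) (sum-cong xs)

  card≤n : ∀ (p : Fin n → Bool) → card p ≤ n
  card≤n p = subst (card p ≤_) (card-∁ p) (ℕₚ.m≤m+n (card p) _)

  card-singleton : ∀ (w : Fin n) → card (_== w) ≤ 1
  card-singleton w = unique-constant (filter⁺ (T? ∘ (_== w)) (allFin⁺ n))
    (λ x∈ → ==⁻ (proj₂ (∈-filter⁻ (T? ∘ (_== w)) {xs = allFin n} x∈)))

least : ∀ {n} (p : Fin n → Bool) →
  (∃ λ u → T (p u) × (∀ z → T (p z) → toℕ u ≤ toℕ z)) ⊎ (∀ z → ¬ T (p z))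
least {zero}  p = inj₂ λ ()
least {suc n} p with T? (p Fin.zero)
... | yes p0 = inj₁ (Fin.zero , p0 , λ _ _ → z≤n)
... | no ¬p0 with least (p ∘ Fin.suc)
...   | inj₁ (u , pu , u≤) = inj₁ (Fin.suc u , pu , λ { Fin.zero p0 → ⊥-elim (¬p0 p0) ; (Fin.suc z) pz → s≤s (u≤ z pz) })
...   | inj₂ none          = inj₂ λ { Fin.zero → ¬p0 ; (Fin.suc z) → none z }

-- Breaker's strategy

module Breaker {n : ℕ} (G : Graph n) (v : Fin n) where

  -- move, acquire, usable, over and legal do not depend on Breaker's strategy or on the
  -- threshold, so any instance of Game may be used to describe them.
  open Game {n} G (λ _ → v , v) 0 using (usable; reach; over; move; acquire; legal; initial)

  live : State n → Fin n → Bool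
  live s x = any (λ y → usable s y x) (allFin n)

  exposed : State n → Fin n → Bool
  exposed s x = not (vis s x) ∧ live s x

  -- `urgent` encodes Breaker's preference for the edge at the walker's position; if that edge is
  -- not usable, `source` may be the other end of any usable edge at the target.
  record Threat (s : State n) : Set where
    field
      source target : Fin n
      edge-usable   : T (usable s source target)
      unvisited     : ¬ T (vis s target)
      minimal       : ∀ z → T (exposed s z) → toℕ target ≤ toℕ z
      urgent        : T (usable s (pos s) target) → source ≡ pos s
  open Threat

  threat : ∀ s u → T (exposed s u) → (∀ z → T (exposed s z) → toℕ u ≤ toℕ z) → Threat s
  threat s u exp u≤ with T? (usable s (pos s) u)
  ... | yes now = record { source = pos s ; target = u ; edge-usable = now ; unvisited = not⁻ (proj₁ (∧⁻ exp))
                         ; minimal = u≤ ; urgent = λ _ → refl }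
  ... | no ¬now = let y , yu = anyFin⁻ (λ y → usable s y u) (proj₂ (∧⁻ {not (vis s u)} exp)) in
    record { source = y ; target = u ; edge-usable = yu ; unvisited = not⁻ (proj₁ (∧⁻ exp))
           ; minimal = u≤ ; urgent = λ now → ⊥-elim (¬now now) }

  decide : ∀ s → Threat s ⊎ (∀ z → ¬ T (exposed s z))
  decide s = Sum.map₁ (λ (u , exp , u≤) → threat s u exp u≤) (least (exposed s))

  choose : State n → Fin n × Fin n
  -- The default `v , v` is never played in a running game: an exposed vertex exists as long as an
  -- unvisited one can be reached.
  choose s = [ (λ θ → source θ , target θ) , (λ _ → v , v) ] (decide s)

  respond : State n → State n
  respond s = acquire s (proj₁ (choose s)) (proj₂ (choose s))

  -- A `Strategy` sees only the walker's positions, so the state on the walker's turn is rebuilt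
  -- from them. She moves first, so Breaker has no reply to the starting vertex; the empty list gets
  -- a default value.
  replay : List (Fin n) → State n
  replay []           = initial v
  replay (w ∷ [])     = initial w
  replay (w ∷ w′ ∷ h) = respond (move (replay (w′ ∷ h)) w)

  strategy : Strategy n
  strategy []      = v , v
  strategy (w ∷ h) = choose (move (replay h) w)

  -- The history is required to be nonempty because `replay (w ∷ h)` unfolds to a response only for
  -- nonempty `h`.
  record Replayed (s : State n) : Set where
    constructor replayed
    field
      {head}  : Fin n
      {tail}  : List (Fin n)
      history : hist s ≡ head ∷ tail
      state   : replay (hist s) ≡ s

  strategy-move : ∀ {s} → Replayed s → ∀ w → strategy (hist (move s w)) ≡ choose (move s w)
  strategy-move (replayed _ state) w = cong (λ s → choose (move s w)) state

  respond-replayed : ∀ {s} → Replayed s → ∀ w → Replayed (respond (move s w))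
  respond-replayed {s} (replayed history state) w = replayed refl (eq (hist s) history state)
    where
    eq : ∀ h {w′ t} → h ≡ w′ ∷ t → replay h ≡ s → replay (w ∷ h) ≡ respond (move s w)
    eq _ refl state = cong (λ s → respond (move s w)) state

  -- Consequences of the game not being over

  -- The last edge of a path to x is usable, so x itself is exposed; a path of length 0 would end at
  -- the visited position.
  exposed-if-reachable : ∀ s → T (vis s (pos s)) → ∀ k x → T (reach s k x) → ¬ T (vis s x) → ∃ λ z → T (exposed s z)
  exposed-if-reachable s pv zero    x r ¬vx = ⊥-elim (¬vx (subst (T ∘ vis s) (≡-sym (==⁻ r)) pv))
  exposed-if-reachable s pv (suc k) x r ¬vx with ∨⁻ {reach s k x} r
  ... | inj₁ r′ = exposed-if-reachable s pv k x r′ ¬vx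
  ... | inj₂ a  = let y , ry = anyFin⁻ (λ y → reach s k y ∧ usable s y x) a in
    x , ∧⁺ (not⁺ ¬vx) (anyFin⁺ (λ y → usable s y x) (proj₂ (∧⁻ {reach s k y} ry)))

  -- The first edge of a path to another vertex is an exit. Hence the list of exits is nonempty and
  -- `avg` does not take its default value 0.
  exit-if-reachable : ∀ s k x → T (reach s k x) → x ≡ pos s ⊎ ∃ λ w → T (usable s (pos s) w)
  exit-if-reachable s zero    x r = inj₁ (==⁻ r)
  exit-if-reachable s (suc k) x r with ∨⁻ {reach s k x} r
  ... | inj₁ r′ = exit-if-reachable s k x r′
  ... | inj₂ a with anyFin⁻ (λ y → reach s k y ∧ usable s y x) a
  ...   | y , ry with exit-if-reachable s k y (proj₁ (∧⁻ ry))
  ...     | inj₂ exit = inj₂ exit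
  ...     | inj₁ refl = inj₂ (x , proj₂ (∧⁻ {reach s k y} ry))

  not-over : ∀ s → over s ≡ false → ∃ λ x → T (reach s n x) × ¬ T (vis s x)
  not-over s eq with any (λ x → reach s n x ∧ not (vis s x)) (allFin n) in e
  ... | true = let x , rx = anyFin⁻ (λ x → reach s n x ∧ not (vis s x)) (Equivalence.from T-≡ e) in
    x , proj₁ (∧⁻ rx) , not⁻ (proj₂ (∧⁻ {reach s n x} rx))

  not-over⇒threat : ∀ s → T (vis s (pos s)) → over s ≡ false →
    Σ (Threat s) λ θ → choose s ≡ (source θ , target θ)
  not-over⇒threat s pv eq = from (decide s) (let x , rx , ¬vx = not-over s eq in exposed-if-reachable s pv n x rx ¬vx)
    where
    from : (d : Threat s ⊎ (∀ z → ¬ T (exposed s z))) → (∃ λ z → T (exposed s z)) →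
      Σ (Threat s) λ θ → [ (λ θ → source θ , target θ) , (λ _ → v , v) ] d ≡ (source θ , target θ)
    from (inj₁ θ)    _         = θ , refl
    from (inj₂ none) (z , exp) = ⊥-elim (none z exp)

  not-over⇒exit : ∀ s → T (vis s (pos s)) → over s ≡ false → ∃ λ w → T (usable s (pos s) w)
  not-over⇒exit s pv eq with not-over s eq
  ... | x , rx , ¬vx with exit-if-reachable s n x rx
  ...   | inj₁ refl = ⊥-elim (¬vx pv)
  ...   | inj₂ exit = exit

  -- P stands for the set of vertices that have been Breaker's target so far.
  record Guarded (P : Fin n → Bool) (s : State n) : Set where
    field
      unseen     : ∀ z → T (P z) → ¬ T (vis s z)
      covered    : ∀ x y → T (acq s x y) → T (P x) ⊎ T (P y)
      -- Exposed vertices only get fewer, so a target remains the least one until it is isolated.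
      foremost   : ∀ z → T (P z) → T (live s z) → ∀ z′ → T (exposed s z′) → toℕ z ≤ toℕ z′
      trav-vis   : ∀ x y → T (trav s x y) → T (vis s x) × T (vis s y)
      pos-vis    : T (vis s (pos s))
  open Guarded

  -- This is an invariant of the walker's turn only: her move may bring her next to a target, and
  -- Breaker's reply restores it.
  Shielded : (Fin n → Bool) → State n → Set
  Shielded P s = ∀ z → T (P z) → ¬ T (usable s (pos s) z)

  guarded-initial : ∀ w → Guarded (λ _ → false) (initial w)
  guarded-initial w = record
    { unseen = λ _ () ; covered = λ _ _ () ; foremost = λ _ () ; trav-vis = λ _ _ () ; pos-vis = ==⁺ refl }

  -- `Shielded` keeps the new position out of `P`. The other conditions survive because visited
  -- vertices only increase and no edge is acquired.
  guarded-move : ∀ {P s w} → Guarded P s → Shielded P s → T (usable s (pos s) w) → Guarded P (move s w)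
  guarded-move {P} {s} {w} g shield uw = record
    { unseen   = λ z Pz → [ unseen g z Pz , (λ z==w → shield z Pz (subst (T ∘ usable s (pos s)) (≡-sym (==⁻ z==w)) uw)) ] ∘ ∨⁻ {vis s z}
    ; covered  = covered g
    ; foremost = λ z Pz lz z′ exp → let unvis , lz′ = ∧⁻ {not (vis s z′ ∨ (z′ == w))} exp in
        foremost g z Pz lz z′ (∧⁺ (not⁺ λ vz′ → not⁻ unvis (∨⁺ (inj₁ vz′))) lz′)
    ; trav-vis = λ x y t → [ (λ t′ → let vx , vy = trav-vis g x y t′ in ∨⁺ (inj₁ vx) , ∨⁺ (inj₁ vy))
        , [ (λ t′ → let e₁ , e₂ = ∧⁻ {x == pos s} t′ in fromPos x (==⁻ e₁) , ∨⁺ {vis s y} (inj₂ e₂))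
          , (λ t′ → let e₁ , e₂ = ∧⁻ {x == w} t′ in ∨⁺ {vis s x} (inj₂ e₁) , fromPos y (==⁻ e₂)) ] ∘ ∨⁻ {(x == pos s) ∧ (y == w)}
        ] (∨⁻ {trav s x y} t)
    ; pos-vis  = ∨⁺ {vis s w} (inj₂ (==⁺ refl))
    }
    where
    fromPos : ∀ x → x ≡ pos s → T (vis s x ∨ (x == w))
    fromPos _ refl = ∨⁺ (inj₁ (pos-vis g))

  _∪_ : (Fin n → Bool) → Fin n → Fin n → Bool
  (P ∪ u) z = P z ∨ (z == u)

  usable-acquire : ∀ s a b x y → T (usable (acquire s a b) x y) → T (usable s x y)
  usable-acquire s a b x y t = let e , ¬a = ∧⁻ {adj G x y} t in
    ∧⁺ e (not⁺ λ a′ → not⁻ ¬a (∨⁺ (inj₁ a′)))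

  live-acquire : ∀ s a b x → T (live (acquire s a b) x) → T (live s x)
  live-acquire s a b x t = let y , uy = anyFin⁻ (λ y → usable (acquire s a b) y x) t in
    anyFin⁺ (λ y → usable s y x) (usable-acquire s a b y x uy)

  acq-acquire : ∀ s a b → T (acq (acquire s a b) a b)
  acq-acquire s a b = ∨⁺ {acq s a b} (inj₂ (∨⁺ {(a == a) ∧ (b == b)} (inj₁ (∧⁺ {a == a} (==⁺ refl) (==⁺ refl)))))

  acquired-unusable : ∀ s a b → ¬ T (usable (acquire s a b) a b)
  acquired-unusable s a b t = not⁻ (proj₂ (∧⁻ {adj G a b} t)) (acq-acquire s a b)

  module _ {P s} (g : Guarded P s) (θ : Threat s) where

    private
      y = source θ
      u = target θ
      s′ = acquire s y u

    exposed-acquire : ∀ z → T (exposed s′ z) → T (exposed s z)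
    exposed-acquire z exp = let ¬v , l = ∧⁻ {not (vis s z)} exp in ∧⁺ ¬v (live-acquire s y u z l)

    guarded-acquire : Guarded (P ∪ u) s′
    guarded-acquire = record
      { unseen   = λ z → [ unseen g z , (λ e → subst (λ z → ¬ T (vis s z)) (≡-sym (==⁻ e)) (unvisited θ)) ] ∘ ∨⁻ {P z}
      ; covered  = λ a b → [ Sum.map (∨⁺ ∘ inj₁) (∨⁺ ∘ inj₁) ∘ covered g a b
          , [ (λ t → inj₂ (∨⁺ {P b} (inj₂ (proj₂ (∧⁻ {a == y} t)))))
            , (λ t → inj₁ (∨⁺ {P a} (inj₂ (proj₁ (∧⁻ {a == u} t))))) ] ∘ ∨⁻ {(a == y) ∧ (b == u)} ] ∘ ∨⁻ {acq s a b}
      ; foremost = λ z Pz lz z′ exp → [ (λ Pz → foremost g z Pz (live-acquire s y u z lz) z′ (exposed-acquire z′ exp))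
          , (λ e → subst (λ z → toℕ z ≤ toℕ z′) (≡-sym (==⁻ e)) (minimal θ z′ (exposed-acquire z′ exp))) ] (∨⁻ {P z} Pz)
      ; trav-vis = trav-vis g
      ; pos-vis  = pos-vis g
      }

    -- If the edge from the walker to the target was usable before the reply, then by `urgent` it is
    -- the edge just acquired.
    target-shielded : ¬ T (usable s′ (pos s) u)
    target-shielded t = acquired-unusable s y u
      (subst (λ x → T (usable s′ x u)) (≡-sym (urgent θ (usable-acquire s y u (pos s) u t))) t)

    -- A protected vertex that is still live is the least exposed vertex, that is, the target.
    shielded-acquire : Shielded (P ∪ u) s′
    shielded-acquire z Pz t = [ old , (λ e → target-shielded (subst (T ∘ usable s′ (pos s)) (==⁻ e) t)) ] (∨⁻ {P z} Pz)
      where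
      old : T (P z) → ⊥
      old Pz = target-shielded (subst (T ∘ usable s′ (pos s)) z≡u t)
        where
        lz : T (live s z)
        lz = anyFin⁺ (λ x → usable s x z) (usable-acquire s y u (pos s) z t)
        exposed-u : T (exposed s u)
        exposed-u = ∧⁺ (not⁺ (unvisited θ)) (anyFin⁺ (λ x → usable s x u) (edge-usable θ))
        z≡u : z ≡ u
        z≡u = Finₚ.toℕ-injective (ℕₚ.≤-antisym (foremost g z Pz lz u exposed-u)
          (minimal θ z (∧⁺ (not⁺ (unseen g z Pz)) lz)))

    -- The target is unvisited while both ends of a traversed edge are visited, so the chosen edge
    -- has not been traversed.
    threat-legal : legal s y u ≡ true
    threat-legal = T⇒≡true (let e , ¬a = ∧⁻ {adj G y u} (edge-usable θ) in
      ∧⁺ e (∧⁺ ¬a (not⁺ λ t → unvisited θ (proj₂ (trav-vis g y u t)))))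

  -- Counting acquired edges and unvisited vertices

  acquiredAt : (Fin n → Bool) → State n → Fin n → ℕ
  acquiredAt P s z = if P z then card (λ y → acq s y z) else 0

  -- A potential for termination: every reply raises it, and it never exceeds n times the number of
  -- targets. It controls both the fuel and the number of moves until L vertices are protected.
  progress : (Fin n → Bool) → State n → ℕ
  progress P s = sum (map (acquiredAt P s) (allFin n))

  progress≤ : ∀ P s → progress P s ≤ n ℕ.* card P
  progress≤ P s = begin
    progress P s                                    ≤⟨ sum-mono bound (allFin n) ⟩
    sum (map (λ z → n ℕ.* bit (P z)) (allFin n))    ≡⟨ sum-* n (bit ∘ P) (allFin n) ⟩
    n ℕ.* sum (map (bit ∘ P) (allFin n))            ≡⟨ cong (n ℕ.*_) (card≡sum P) ⟨
    n ℕ.* card P                                    ∎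
    where
    open ℕₚ.≤-Reasoning
    bound : ∀ z → acquiredAt P s z ≤ n ℕ.* bit (P z)
    bound z with P z
    ... | true  = ℕₚ.≤-trans (card≤n (λ y → acq s y z)) (ℕₚ.≤-reflexive (≡-sym (ℕₚ.*-identityʳ n)))
    ... | false = z≤n

  -- The new edge is counted at the summand of the target, which may or may not have been in `P`
  -- before.
  progress-acquire : ∀ P s (θ : Threat s) → progress P s ℕ.< progress (P ∪ target θ) (acquire s (source θ) (target θ))
  progress-acquire P s θ = sum-strict grows (∈-allFin u) strict
    where
    y = source θ
    u = target θ
    s′ = acquire s y u
    subset : ∀ z x → T (acq s x z) → T (acq s′ x z)
    subset z x a = ∨⁺ (inj₁ a)
    grows : ∀ z → acquiredAt P s z ≤ acquiredAt (P ∪ u) s′ z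
    grows z with P z
    ... | true  = card-mono (subset z)
    ... | false = z≤n
    ∪-contains : ∀ b → ∀ {c} → T c → ∀ k → (if b ∨ c then k else 0) ≡ k
    ∪-contains true  _ k = refl
    ∪-contains false {true} _ k = refl
    at-most : ∀ b {k} → (if b then k else 0) ≤ k
    at-most true  = ℕₚ.≤-refl
    at-most false = z≤n
    strict : acquiredAt P s u ℕ.< acquiredAt (P ∪ u) s′ u
    strict = ℕₚ.≤-<-trans (at-most (P u)) (subst (card (λ x → acq s x u) ℕ.<_)
      (≡-sym (∪-contains (P u) {u == u} (==⁺ refl) (card (λ x → acq s′ x u))))
      (card-strict (subset u) y (not⁻ (proj₂ (∧⁻ {adj G y u} (edge-usable θ))))
        (acq-acquire s y u)))

  -- An acquired edge at the walker's position has an end in `P`. The position is visited and hence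
  -- not in `P`, so the other end is.
  degree≤ : ∀ {P s} → Guarded P s → degree G (pos s) ≤ card (usable s (pos s)) ℕ.+ card P
  degree≤ {P} {s} g = card-∪ λ x e → split x e (T? (acq s (pos s) x))
    where
    split : ∀ x → T (adj G (pos s) x) → _ → T (usable s (pos s) x) ⊎ T (P x)
    split x e (no ¬a) = inj₁ (∧⁺ e (not⁺ ¬a))
    split x e (yes a) = [ (λ Pp → ⊥-elim (unseen g (pos s) Pp (pos-vis g))) , inj₂ ] (covered g (pos s) x a)

  missing : State n → ℕ
  missing s = card (not ∘ vis s)

  missing-move-old : ∀ s w → T (vis s w) → missing s ≤ missing (move s w)
  missing-move-old s w vw = card-mono λ x ¬vx → not⁺
    ([ not⁻ ¬vx , (λ e → not⁻ ¬vx (subst (T ∘ vis s) (≡-sym (==⁻ e)) vw)) ] ∘ ∨⁻ {vis s x})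

  missing-move : ∀ s w → missing s ≤ suc (missing (move s w))
  missing-move s w = ℕₚ.≤-trans (card-∪ {q = not ∘ vis (move s w)} {r = _== w} λ x ¬vx → split x ¬vx (T? (x == w)))
    (ℕₚ.≤-trans (ℕₚ.+-monoʳ-≤ (missing (move s w)) (card-singleton w)) (ℕₚ.≤-reflexive (ℕₚ.+-comm (missing (move s w)) 1)))
    where
    split : ∀ x → T (not (vis s x)) → _ → T (not (vis s x ∨ (x == w))) ⊎ T (x == w)
    split x ¬vx (yes e) = inj₂ e
    split x ¬vx (no ¬e) = inj₁ (not⁺ ([ not⁻ ¬vx , ¬e ] ∘ ∨⁻ {vis s x}))

  n≤1+missing-initial : ∀ w → n ≤ suc (missing (initial w))
  n≤1+missing-initial w = subst (_≤ suc (missing (initial w))) (card-∁ (_== w)) (ℕₚ.+-monoˡ-≤ (missing (initial w)) (card-singleton w))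

  guarded⇒missing : ∀ {P s} → Guarded P s → card P ≤ missing s
  guarded⇒missing g = card-mono λ z Pz → not⁺ (unseen g z Pz)

-- The bound for the failure probability

inv-antitone : ∀ {m k} → m ≤ k → inv k Q.≤ inv m
inv-antitone {m} {k} m≤k = begin
  inv k                                   ≡⟨ Qₚ.*-identityʳ (inv k) ⟨
  inv k * 1ℚ                              ≡⟨ cong (inv k *_) (inv-inverse m) ⟨
  inv k * (inv m * ℕ→ℚ (suc m))           ≤⟨ *-monoˡ {inv k} (0≤inv k) (*-monoˡ {inv m} (0≤inv m) (ℕ→ℚ-mono (s≤s m≤k))) ⟩
  inv k * (inv m * ℕ→ℚ (suc k))           ≡⟨ solve 3 (λ a b c → a :* (b :* c) := b :* (a :* c)) refl (inv k) (inv m) (ℕ→ℚ (suc k)) ⟩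
  inv m * (inv k * ℕ→ℚ (suc k))           ≡⟨ cong (inv m *_) (inv-inverse k) ⟩
  inv m * 1ℚ                              ≡⟨ Qₚ.*-identityʳ (inv m) ⟩
  inv m                                   ∎
  where open Qₚ.≤-Reasoning

-- For W ≥ 1 this is the identity W (1 / W - 1 / (W + 1)) = 1 / (W + 1), and for W = 0 the left side
-- vanishes. It bounds the total increase over all exits to unvisited vertices.
inv-drop : ∀ W → ℕ→ℚ W * (inv (W ∸ 1) - inv W) Q.≤ inv W
inv-drop zero    = 0≤inv 0
inv-drop (suc V) = Qₚ.≤-reflexive (begin
  ν * (a - b)                       ≡⟨ solve 3 (λ ν a b → ν :* (a :- b) := a :* ν :- b :* (con 1ℚ :+ ν) :+ b) refl ν a b ⟩
  a * ν - b * (1ℚ + ν) + b          ≡⟨ cong (λ z → a * ν - b * z + b) (ℕ→ℚ-+ 1 (suc V)) ⟨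
  a * ν - b * ℕ→ℚ (suc (suc V)) + b ≡⟨ cong₂ (λ z z′ → z - z′ + b) (inv-inverse V) (inv-inverse (suc V)) ⟩
  1ℚ - 1ℚ + b                       ≡⟨ Qₚ.+-identityˡ b ⟩
  b                                 ∎)
  where
  open ≡-Reasoning
  ν = ℕ→ℚ (suc V)
  a = inv V
  b = inv (suc V)

0≤inv-drop : ∀ W → 0ℚ Q.≤ inv (W ∸ 1) - inv W
0≤inv-drop W = subst (Q._≤ inv (W ∸ 1) - inv W) (Qₚ.+-inverseʳ (inv W))
  (Qₚ.+-monoˡ-≤ (- inv W) (inv-antitone (ℕₚ.m∸n≤m W 1)))

1-antitone : ∀ {d e} → d Q.≤ e → 1ℚ - e Q.≤ 1ℚ - d
1-antitone d≤e = Qₚ.+-monoʳ-≤ 1ℚ (Qₚ.neg-antimono-≤ d≤e)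

1-e≤1 : ∀ {e} → 0ℚ Q.≤ e → 1ℚ - e Q.≤ 1ℚ
1-e≤1 0≤e = 1-antitone {0ℚ} 0≤e

if-≥ : ∀ {z x y} b → (b ≡ true → z Q.≤ x) → (b ≡ false → z Q.≤ y) → z Q.≤ (if b then x else y)
if-≥ true  h _ = h refl
if-≥ false _ h = h refl

module _ {A : Set} where

  avg-≥ : ∀ (f : A → ℚ) {β} xs → 1 ≤ length xs → ℕ→ℚ (length xs) * β Q.≤ sumℚ (map f xs) → β Q.≤ avg (map f xs)
  avg-≥ f {β} (x ∷ xs) _ h = subst (λ k → β Q.≤ sumℚ (map f (x ∷ xs)) * inv k) (≡-sym (length-map f xs)) (begin
    β                                                   ≡⟨ *-identity-swap {inv k} {ℕ→ℚ (suc k)} β (inv-inverse k) ⟨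
    inv k * (ℕ→ℚ (suc k) * β)                           ≤⟨ *-monoˡ {inv k} (0≤inv k) h ⟩
    inv k * sumℚ (map f (x ∷ xs))                       ≡⟨ Qₚ.*-comm (inv k) _ ⟩
    sumℚ (map f (x ∷ xs)) * inv k                       ∎)
    where
    open Qₚ.≤-Reasoning
    k = length xs

  length-filterᵇ-∷ : ∀ (p : A → Bool) x xs → length (filterᵇ p (x ∷ xs)) ≡ bit (p x) ℕ.+ length (filterᵇ p xs)
  length-filterᵇ-∷ p x xs with p x
  ... | true  = refl
  ... | false = refl

  sum-≥ : ∀ (f : A → ℚ) (bad : A → Bool) β γ xs → (∀ {x} → x ∈ xs → β Q.≤ f x + ℕ→ℚ (bit (bad x)) * γ) →
    ℕ→ℚ (length xs) * β Q.≤ sumℚ (map f xs) + ℕ→ℚ (length (filterᵇ bad xs)) * γ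
  sum-≥ f bad β γ []       _ = Qₚ.≤-reflexive (trans (Qₚ.*-zeroˡ β) (≡-sym (trans (Qₚ.+-identityˡ _) (Qₚ.*-zeroˡ γ))))
  sum-≥ f bad β γ (x ∷ xs) h = begin
    ℕ→ℚ (suc (length xs)) * β             ≡⟨ cong (_* β) (ℕ→ℚ-+ 1 (length xs)) ⟩
    (1ℚ + ℕ→ℚ (length xs)) * β            ≡⟨ solve 2 (λ l β → (con 1ℚ :+ l) :* β := β :+ l :* β) refl (ℕ→ℚ (length xs)) β ⟩
    β + ℕ→ℚ (length xs) * β               ≤⟨ Qₚ.+-mono-≤ (h (here refl)) (sum-≥ f bad β γ xs (h ∘ there)) ⟩
    (f x + i * γ) + (S + j * γ)           ≡⟨ solve 5 (λ a i γ S j → (a :+ i :* γ) :+ (S :+ j :* γ) := (a :+ S) :+ (i :+ j) :* γ) refl (f x) i γ S j ⟩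
    (f x + S) + (i + j) * γ               ≡⟨ cong (λ z → (f x + S) + z * γ) (ℕ→ℚ-+ (bit (bad x)) (length (filterᵇ bad xs))) ⟨
    (f x + S) + ℕ→ℚ (bit (bad x) ℕ.+ length (filterᵇ bad xs)) * γ ≡⟨ cong (λ z → (f x + S) + ℕ→ℚ z * γ) (length-filterᵇ-∷ bad x xs) ⟨
    (f x + S) + ℕ→ℚ (length (filterᵇ bad (x ∷ xs))) * γ ∎
    where
    open Qₚ.≤-Reasoning
    i = ℕ→ℚ (bit (bad x))
    j = ℕ→ℚ (length (filterᵇ bad xs))
    S = sumℚ (map f xs)

  avg-≥-uniform : ∀ (f : A → ℚ) β xs → 1 ≤ length xs → (∀ {x} → x ∈ xs → β Q.≤ f x) → β Q.≤ avg (map f xs)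
  avg-≥-uniform f β xs nonempty h = avg-≥ f {β} xs nonempty (subst (ℕ→ℚ (length xs) * β Q.≤_) (drop-zero (sumℚ (map f xs)) (ℕ→ℚ (length (filterᵇ (λ _ → false) xs))))
    (sum-≥ f (λ _ → false) β 0ℚ xs (λ {x} x∈ → subst (β Q.≤_) (≡-sym (drop-zero (f x) 0ℚ)) (h x∈))))
    where
    drop-zero : ∀ a b → a + b * 0ℚ ≡ a
    drop-zero a b = trans (cong (a +_) (Qₚ.*-zeroʳ b)) (Qₚ.+-identityʳ a)

-- Here D counts the exits, κ those to unvisited vertices, and g is the increase of a = 1 / (W + 1)
-- at each of these. The total loss κ C g ≤ C a is paid for by D (q - 1) C a ≥ C a.
averaging : ∀ {D κ C a g q S} → 0ℚ Q.≤ C → 0ℚ Q.≤ a → 1ℚ Q.≤ D * (q - 1ℚ) → κ * g Q.≤ a →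
  D * (1ℚ - C * a) Q.≤ S + κ * (C * g) → D * (1ℚ - C * (q * a)) Q.≤ S
averaging {D} {κ} {C} {a} {g} {q} {S} 0≤C 0≤a 1≤Dq κg≤a h = begin
  D * (1ℚ - C * (q * a))                                    ≡⟨ solve 4 (λ D C q a → D :* (con 1ℚ :- C :* (q :* a)) := D :* (con 1ℚ :- C :* a) :- C :* a :* (D :* (q :- con 1ℚ))) refl D C q a ⟩
  D * (1ℚ - C * a) - C * a * (D * (q - 1ℚ))                 ≤⟨ Qₚ.+-mono-≤ h (Qₚ.neg-antimono-≤ (*-monoˡ {C * a} (0≤* 0≤C 0≤a) 1≤Dq)) ⟩
  S + κ * (C * g) - C * a * 1ℚ                              ≡⟨ solve 5 (λ S κ C g a → S :+ κ :* (C :* g) :- C :* a :* con 1ℚ := S :+ C :* (κ :* g) :- C :* a) refl S κ C g a ⟩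
  S + C * (κ * g) - C * a                                   ≤⟨ Qₚ.+-monoˡ-≤ (- (C * a)) (Qₚ.+-monoʳ-≤ S (*-monoˡ {C} 0≤C κg≤a)) ⟩
  S + C * a - C * a                                         ≡⟨ solve 3 (λ S C a → S :+ C :* a :- C :* a := S) refl S C a ⟩
  S                                                         ∎
  where open Qₚ.≤-Reasoning

-- A reply trades one unit of fuel, or of the step budget, for at least one unit of progress.
k≤1+f+p : ∀ {k f p p′} → k ≤ suc f ℕ.+ p → p ℕ.< p′ → k ≤ f ℕ.+ p′
k≤1+f+p {k} {f} {p} {p′} k≤ p<p′ = ℕₚ.≤-trans k≤ (ℕₚ.≤-trans (ℕₚ.≤-reflexive (≡-sym (ℕₚ.+-suc f p))) (ℕₚ.+-monoʳ-≤ f p<p′))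

-- Induction over the game

module Value {n : ℕ} (G : Graph n) (v : Fin n) (L : ℕ) (L≤n : L ≤ n) (q : ℚ) (1≤q : 1ℚ Q.≤ q)
  (enough-exits : ∀ u D → degree G u ≤ D ℕ.+ L → 1ℚ Q.≤ ℕ→ℚ D * (q - 1ℚ)) where

  open Breaker G v
  open Guarded
  open Game {n} G strategy (n ∸ L)

  0≤q : 0ℚ Q.≤ q
  0≤q = Qₚ.≤-trans 0≤1 1≤q

  -- `scale b * inv W` is the Markov bound when W vertices are unvisited and b steps are to come.
  scale : ℕ → ℚ
  scale b = ℕ→ℚ L * q ^ℚ b

  0≤scale : ∀ b → 0ℚ Q.≤ scale b
  0≤scale b = 0≤* (0≤ℕ→ℚ L) (0≤^ 0≤q b)

  -- b bounds the number of further steps of the walker until L vertices are protected; k is b on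
  -- the walker's turn and b + 1 on Breaker's, who is then about to make progress. Once L vertices
  -- are protected nothing is left to chance, so any e ≥ 0 is a valid bound for the failure probability.
  Budget : (Fin n → Bool) → State n → ℕ → ℕ → ℚ → Set
  Budget P s k b e = (L ≤ card P × 0ℚ Q.≤ e) ⊎ (L ℕ.* n ≤ k ℕ.+ progress P s × scale b * inv (missing s) Q.≤ e)

  outcome-≥ : ∀ s e → (L ≤ missing s × 0ℚ Q.≤ e) ⊎ (1ℚ Q.≤ e) → 1ℚ - e Q.≤ outcome s
  outcome-≥ s e (inj₁ (L≤W , 0≤e)) = if-≥ {1ℚ - e} (card (vis s) ℕ.≤ᵇ (n ∸ L)) (λ _ → 1-e≤1 {e} 0≤e)
    (λ eq → ⊥-elim (subst T eq (ℕₚ.≤⇒≤ᵇ few)))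
    where
    few : card (vis s) ≤ n ∸ L
    few = ℕₚ.≤-trans (ℕₚ.≤-reflexive (≡-sym (trans (cong (_∸ missing s) (≡-sym (card-∁ (vis s)))) (ℕₚ.m+n∸n≡m (card (vis s)) (missing s)))))
                     (ℕₚ.∸-monoʳ-≤ n L≤W)
  outcome-≥ s e (inj₂ 1≤e) = if-≥ {1ℚ - e} (card (vis s) ℕ.≤ᵇ (n ∸ L)) (λ _ → 1-e≤1 {e} (Qₚ.≤-trans 0≤1 1≤e)) (λ _ → 1-antitone {1ℚ} {e} 1≤e)

  -- This is Markov's inequality: if fewer than L vertices are left, then L / (W + 1) ≥ 1 and the
  -- failure bound is trivial.
  settled : ∀ {P s k b e} → Guarded P s → Budget P s k b e → (L ≤ missing s × 0ℚ Q.≤ e) ⊎ (1ℚ Q.≤ e)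
  settled g (inj₁ (L≤P , 0≤e)) = inj₁ (ℕₚ.≤-trans L≤P (guarded⇒missing g) , 0≤e)
  settled {P} {s} {k} {b} {e} g (inj₂ (_ , ≤e)) = by-size (L ℕ.≤? missing s)
    where
    open Qₚ.≤-Reasoning
    by-size : Dec (L ≤ missing s) → (L ≤ missing s × 0ℚ Q.≤ e) ⊎ (1ℚ Q.≤ e)
    by-size (yes L≤W) = inj₁ (L≤W , Qₚ.≤-trans (0≤* {scale b} (0≤scale b) (0≤inv (missing s))) ≤e)
    by-size (no  L≰W) = inj₂ (begin
      1ℚ                                        ≡⟨ inv-inverse (missing s) ⟨
      inv (missing s) * ℕ→ℚ (suc (missing s))   ≤⟨ *-monoˡ {inv (missing s)} (0≤inv (missing s)) (ℕ→ℚ-mono (ℕₚ.≰⇒> L≰W)) ⟩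
      inv (missing s) * ℕ→ℚ L                   ≡⟨ solve 2 (λ w l → w :* l := l :* con 1ℚ :* w) refl (inv (missing s)) (ℕ→ℚ L) ⟩
      ℕ→ℚ L * 1ℚ * inv (missing s)              ≤⟨ *-monoʳ {inv (missing s)} {ℕ→ℚ L * 1ℚ} {scale b} (0≤inv (missing s)) (*-monoˡ {ℕ→ℚ L} (0≤ℕ→ℚ L) (1≤^ {q} 1≤q b)) ⟩
      scale b * inv (missing s)                 ≤⟨ ≤e ⟩
      e                                         ∎)

  -- `breakerTurn` matches on the strategy's answer, so it unfolds only after that answer has been
  -- abstracted.
  breakerTurn-choice : ∀ f s y u → strategy (hist s) ≡ (y , u) →
    breakerTurn f s ≡ (if over s then outcome s else (if legal s y u then walkerTurn f (acquire s y u) else 0ℚ))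
  breakerTurn-choice f s y u eq with strategy (hist s) | eq
  ... | _ | refl = refl

  exits : State n → List (Fin n)
  exits s = filterᵇ (usable s (pos s)) (allFin n)

  ∈-exits : ∀ {s w} → w ∈ exits s → T (usable s (pos s) w)
  ∈-exits {s} w∈ = proj₂ (∈-filter⁻ (T? ∘ usable s (pos s)) {xs = allFin n} w∈)

  exits-nonempty : ∀ {P s} → Guarded P s → over s ≡ false → 1 ≤ length (exits s)
  exits-nonempty {P} {s} g eq = nonempty (let w , uw = not-over⇒exit s (pos-vis g) eq in
    ∈-filter⁺ (T? ∘ usable s (pos s)) (∈-allFin w) uw)
    where
    nonempty : ∀ {w ws} → w ∈ ws → 1 ≤ length ws
    nonempty (here _)  = s≤s z≤n
    nonempty (there _) = s≤s z≤n

  child-inv : ∀ s w → inv (missing (move s w)) Q.≤ inv (missing s) + ℕ→ℚ (bit (not (vis s w))) * (inv (missing s ∸ 1) - inv (missing s))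
  child-inv s w = by-visit (vis s w) refl
    where
    a = inv (missing s)
    a′ = inv (missing s ∸ 1)
    by-visit : ∀ b → vis s w ≡ b → inv (missing (move s w)) Q.≤ a + ℕ→ℚ (bit (not b)) * (a′ - a)
    by-visit true  eq = Qₚ.≤-trans (inv-antitone (missing-move-old s w (subst T (≡-sym eq) _)))
      (Qₚ.≤-reflexive (solve 2 (λ a g → a := a :+ con 0ℚ :* g) refl a (a′ - a)))
    by-visit false eq = Qₚ.≤-trans (inv-antitone (ℕₚ.∸-monoˡ-≤ 1 (missing-move s w)))
      (Qₚ.≤-reflexive (solve 2 (λ a a′ → a′ := a :+ con 1ℚ :* (a′ :- a)) refl a a′))

  -- The supermartingale step: averaging over the exits costs one factor q, because at most W of
  -- them increase 1 / (W + 1) and fewer than L vertices' worth of edges could be lost at the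
  -- position, or exactly L.
  avg-exits : ∀ {P s} → Guarded P s → over s ≡ false → card P ≤ L → ∀ b (h : Fin n → ℚ) →
    (∀ {w} → w ∈ exits s → 1ℚ - scale b * inv (missing (move s w)) Q.≤ h w) →
    1ℚ - scale (suc b) * inv (missing s) Q.≤ avg (map h (exits s))
  avg-exits {P} {s} g eq P≤L b h h≥ = subst (λ z → 1ℚ - z Q.≤ avg (map h (exits s)))
    (solve 4 (λ l q c a → l :* c :* (q :* a) := l :* (q :* c) :* a) refl (ℕ→ℚ L) q (q ^ℚ b) a)
    (avg-≥ h {1ℚ - C * (q * a)} (exits s) (exits-nonempty g eq)
      (averaging {ℕ→ℚ D} {ℕ→ℚ κ} {C} {a} {γ} {q} {sumℚ (map h (exits s))} (0≤scale b) (0≤inv (missing s))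
        (enough-exits (pos s) D (ℕₚ.≤-trans (degree≤ g) (ℕₚ.+-monoʳ-≤ D P≤L)))
        (Qₚ.≤-trans (*-monoʳ {γ} {ℕ→ℚ κ} {ℕ→ℚ (missing s)} (0≤inv-drop (missing s))
            (ℕ→ℚ-mono (length-filterᵇ-filterᵇ (usable s (pos s)) (not ∘ vis s) (allFin n))))
          (inv-drop (missing s)))
        (sum-≥ h (not ∘ vis s) (1ℚ - C * a) (C * γ) (exits s) child)))
    where
    open Qₚ.≤-Reasoning
    a = inv (missing s)
    γ = inv (missing s ∸ 1) - a
    C = scale b
    D = length (exits s)
    κ = length (filterᵇ (not ∘ vis s) (exits s))
    child : ∀ {w} → w ∈ exits s → 1ℚ - C * a Q.≤ h w + ℕ→ℚ (bit (not (vis s w))) * (C * γ)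
    child {w} w∈ = begin
      1ℚ - C * a                          ≡⟨ solve 4 (λ C a i γ → con 1ℚ :- C :* a := con 1ℚ :- C :* (a :+ i :* γ) :+ i :* (C :* γ)) refl C a i γ ⟩
      1ℚ - C * (a + i * γ) + i * (C * γ)  ≤⟨ Qₚ.+-monoˡ-≤ (i * (C * γ)) (Qₚ.≤-trans (1-antitone {C * inv (missing (move s w))} {C * (a + i * γ)} (*-monoˡ {C} (0≤scale b) (child-inv s w))) (h≥ w∈)) ⟩
      h w + i * (C * γ)                   ∎
      where i = ℕ→ℚ (bit (not (vis s w)))

  -- Stated for an arbitrary pair `c`, so that it can be proved for the edge of a threat and
  -- transported to `choose s`.
  record Response (P : Fin n → Bool) (s : State n) (c : Fin n × Fin n) : Set where
    s′ : State n
    s′ = acquire s (proj₁ c) (proj₂ c)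
    field
      P′       : Fin n → Bool
      guarded  : Guarded P′ s′
      shielded : Shielded P′ s′
      extends  : card P ≤ card P′
      advances : progress P s ℕ.< progress P′ s′
      lawful   : legal s (proj₁ c) (proj₂ c) ≡ true

  response : ∀ {P s} → Guarded P s → over s ≡ false → Response P s (choose s)
  response {P} {s} g eq = let θ , chosen = not-over⇒threat s (pos-vis g) eq in
    subst (Response P s) (≡-sym chosen) (record
      { P′ = P ∪ Threat.target θ ; guarded = guarded-acquire g θ ; shielded = shielded-acquire g θ
      ; extends = card-mono (λ z Pz → ∨⁺ {P z} (inj₁ Pz)) ; advances = progress-acquire P s θ ; lawful = threat-legal g θ })

  -- With no steps left, progress has reached L n, and as it is at most n times the number of
  -- targets, L vertices are protected. Otherwise one step can be spent.
  refine : ∀ {P s b e} → Budget P s b b e →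
    (L ≤ card P × 0ℚ Q.≤ e) ⊎ (card P ≤ L × ∃ λ b′ → L ℕ.* n ≤ suc b′ ℕ.+ progress P s × scale (suc b′) * inv (missing s) Q.≤ e)
  refine (inj₁ secure) = inj₁ secure
  refine {P} {s} {b} {e} (inj₂ (Ln≤ , ≤e)) = by-size (L ℕ.≤? card P) b Ln≤ ≤e
    where
    instance _ = Finₚ.nonZeroIndex v
    by-size : Dec (L ≤ card P) → ∀ b → L ℕ.* n ≤ b ℕ.+ progress P s → scale b * inv (missing s) Q.≤ e →
      (L ≤ card P × 0ℚ Q.≤ e) ⊎ (card P ≤ L × ∃ λ b′ → L ℕ.* n ≤ suc b′ ℕ.+ progress P s × scale (suc b′) * inv (missing s) Q.≤ e)
    by-size (yes L≤P) b _ ≤e = inj₁ (L≤P , Qₚ.≤-trans (0≤* {scale b} (0≤scale b) (0≤inv (missing s))) ≤e)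
    by-size (no  L≰P) zero Ln≤ _ = ⊥-elim (L≰P (ℕₚ.*-cancelʳ-≤ L (card P) n
      (ℕₚ.≤-trans Ln≤ (ℕₚ.≤-trans (progress≤ P s) (ℕₚ.≤-reflexive (ℕₚ.*-comm n (card P)))))))
    by-size (no  L≰P) (suc b′) Ln≤ ≤e = inj₂ (ℕₚ.<⇒≤ (ℕₚ.≰⇒> L≰P) , b′ , Ln≤ , ≤e)

  -- Simultaneous induction on the fuel. Progress is at most n^2, so the strict inequality prevents
  -- the fuel from running out. Breaker's turn has one unit more on the right, since his reply is
  -- about to add progress.
  walker-≥ : ∀ f {P s} b e → Replayed s → Guarded P s → Shielded P s → n ℕ.* n ℕ.< f ℕ.+ progress P s →
    Budget P s b b e → 1ℚ - e Q.≤ walkerTurn f s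
  breaker-≥ : ∀ f {P s} b e → strategy (hist s) ≡ choose s → Replayed (respond s) → Guarded P s → n ℕ.* n ℕ.< suc f ℕ.+ progress P s →
    Budget P s (suc b) b e → 1ℚ - e Q.≤ breakerTurn f s

  walker-≥ zero {P} {s} b e _ _ _ fuel _ = ⊥-elim (ℕₚ.<⇒≱ fuel
    (ℕₚ.≤-trans (progress≤ P s) (ℕₚ.*-monoʳ-≤ n (card≤n P))))
  walker-≥ (suc f) {P} {s} b e rep g shield fuel budget = if-≥ {1ℚ - e} (over s)
    (λ _ → outcome-≥ s e (settled {P} {s} {b} {b} {e} g budget))
    (λ eq → [ (λ (L≤P , 0≤e) → avg-≥-uniform h (1ℚ - e) (exits s) (exits-nonempty g eq)
                -- Once L vertices are protected, the same e serves every exit, and 0 is a dummy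
                -- number of steps.
                (λ w∈ → child w∈ 0 e (inj₁ (L≤P , 0≤e))))
            , (λ (P≤L , b′ , Ln≤ , ≤e) → Qₚ.≤-trans (1-antitone {scale (suc b′) * inv (missing s)} {e} ≤e)
                (avg-exits g eq P≤L b′ h (λ {w} w∈ → child w∈ b′ (scale b′ * inv (missing (move s w))) (inj₂ (Ln≤ , Qₚ.≤-refl)))))
            ] (refine {P} {s} {b} {e} budget))
    where
    h : Fin n → ℚ
    h w = breakerTurn f (move s w)
    child : ∀ {w} → w ∈ exits s → ∀ b′ e′ → Budget P (move s w) (suc b′) b′ e′ → 1ℚ - e′ Q.≤ h w
    child {w} w∈ b′ e′ = breaker-≥ f {P} {move s w} b′ e′ (strategy-move rep w) (respond-replayed rep w)
      (guarded-move g shield (∈-exits {s} w∈)) fuel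

  breaker-≥ f {P} {s} b e chosen rep g fuel budget = subst (1ℚ - e Q.≤_)
    (≡-sym (breakerTurn-choice f s (proj₁ (choose s)) (proj₂ (choose s)) chosen))
    (if-≥ {1ℚ - e} (over s) (λ _ → outcome-≥ s e (settled {P} {s} {suc b} {b} {e} g budget))
      (λ eq → proceed (response g eq)))
    where
    proceed : Response P s (choose s) → 1ℚ - e Q.≤ (if legal s (proj₁ (choose s)) (proj₂ (choose s)) then walkerTurn f (respond s) else 0ℚ)
    proceed r = if-≥ {1ℚ - e} (legal s (proj₁ (choose s)) (proj₂ (choose s)))
      (λ _ → walker-≥ f {P′} {respond s} b e rep guarded shielded (k≤1+f+p fuel advances)
        (Sum.map (λ (L≤P , 0≤e) → ℕₚ.≤-trans L≤P extends , 0≤e) (λ (Ln≤ , ≤e) → k≤1+f+p Ln≤ advances , ≤e) budget))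
      (λ illegal → ⊥-elim (subst T (trans (≡-sym lawful) illegal) _))
      where open Response r

  -- At the start there is no progress, so n L steps are budgeted, and at least n - 1 vertices are
  -- unvisited, so 1 / (W + 1) ≤ 1 / n.
  probability-≥ : ∀ e → scale (n ℕ.* L) * inv (n ∸ 1) Q.≤ e → 1ℚ - e Q.≤ probAtMost G strategy v (n ∸ L)
  probability-≥ e ≤e = walker-≥ (suc (n ℕ.* n)) {λ _ → false} {initial v} (n ℕ.* L) e (replayed refl refl) (guarded-initial v) (λ _ ())
    (ℕₚ.m≤m+n (suc (n ℕ.* n)) (progress (λ _ → false) (initial v)))
    (inj₂ (ℕₚ.≤-trans (ℕₚ.≤-reflexive (ℕₚ.*-comm L n)) (ℕₚ.m≤m+n (n ℕ.* L) (progress (λ _ → false) (initial v)))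
          , Qₚ.≤-trans (*-monoˡ {scale (n ℕ.* L)} (0≤scale (n ℕ.* L)) (inv-antitone (ℕₚ.∸-monoˡ-≤ 1 (n≤1+missing-initial v)))) ≤e))

-- Choice of the parameters and conclusion

module _ {α a x : ℚ} (0≤x : 0ℚ Q.≤ x) (ax≡1 : a * x ≡ 1ℚ) {m : ℕ} (G : Graph (suc m)) (dense : MinDegreeAtLeast G α)
  {L : ℕ} (L≤δn : ℕ→ℚ L Q.≤ (α - a) * ℕ→ℚ (suc m)) where

  -- The degree condition gives D ≥ α n - L ≥ a n, and x / n = 1 / (a n).
  many-exits : ∀ u D → degree G u ≤ D ℕ.+ L → 1ℚ Q.≤ ℕ→ℚ D * ((1ℚ + x * inv m) - 1ℚ)
  many-exits u D deg≤ = begin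
    1ℚ                                      ≡⟨ cong₂ _*_ ax≡1 (inv-inverse m) ⟨
    a * x * (w * ν)                         ≡⟨ solve 4 (λ a x w ν → a :* x :* (w :* ν) := a :* ν :* (x :* w)) refl a x w ν ⟩
    a * ν * (x * w)                         ≤⟨ *-monoʳ {x * w} (0≤* 0≤x (0≤inv m)) aν≤D ⟩
    ℕ→ℚ D * (x * w)                         ≡⟨ solve 2 (λ d z → d :* z := d :* ((con 1ℚ :+ z) :- con 1ℚ)) refl (ℕ→ℚ D) (x * w) ⟩
    ℕ→ℚ D * ((1ℚ + x * w) - 1ℚ)             ∎
    where
    open Qₚ.≤-Reasoning
    w = inv m
    ν = ℕ→ℚ (suc m)
    aν≤D : a * ν Q.≤ ℕ→ℚ D
    aν≤D = begin
      a * ν                                 ≡⟨ solve 3 (λ α a ν → a :* ν := α :* ν :- (α :- a) :* ν) refl α a ν ⟩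
      α * ν - (α - a) * ν                   ≤⟨ Qₚ.+-mono-≤ (Qₚ.≤-trans (dense u) (ℕ→ℚ-mono deg≤)) (Qₚ.neg-antimono-≤ L≤δn) ⟩
      ℕ→ℚ (D ℕ.+ L) - ℕ→ℚ L                 ≡⟨ cong (_- ℕ→ℚ L) (ℕ→ℚ-+ D L) ⟩
      ℕ→ℚ D + ℕ→ℚ L - ℕ→ℚ L                 ≡⟨ solve 2 (λ d l → d :+ l :- l := d) refl (ℕ→ℚ D) (ℕ→ℚ L) ⟩
      ℕ→ℚ D                                 ∎

reciprocal-antitone : ∀ {c a x y} → 0ℚ < c → 0ℚ < x → c < a → a * x ≡ 1ℚ → c * y ≡ 1ℚ → x < y
reciprocal-antitone {c} {a} {x} {y} 0<c 0<x c<a ax≡1 cy≡1 =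
  Qₚ.*-cancelˡ-<-nonNeg c {{Q.nonNegative (Qₚ.<⇒≤ 0<c)}} {x} {y}
    (subst (c * x <_) (trans ax≡1 (≡-sym cy≡1)) (Qₚ.*-monoˡ-<-pos x {{Q.positive 0<x}} c<a))

-- Division by c unfolds to multiplication by `1/ c`, the first component of `reciprocal cpos`.
LnLe⇒CLnLe : ∀ {c} (cpos : 0ℚ < c) n k → LnLe n (ℕ→ℚ k * proj₁ (reciprocal cpos)) → CLnLe c cpos n k
LnLe⇒CLnLe cpos n k ln≤ = ln≤

module _ {α a x y ε : ℚ} (0≤x : 0ℚ Q.≤ x) (ax≡1 : a * x ≡ 1ℚ) {m : ℕ} (G : Graph (suc m)) (dense : MinDegreeAtLeast G α)
  (v : Fin (suc m)) (size : TargetSize x y (α - a) ε m) where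

  open TargetSize size

  breaker-wins : 1ℚ - ε Q.≤ probAtMost G (Breaker.strategy G v) v (suc m ∸ L)
  breaker-wins = Value.probability-≥ G v L L≤n (1ℚ + x * inv m) (1≤1+ {x * inv m} (0≤* 0≤x (0≤inv m)))
    (many-exits {α} {a} {x} 0≤x ax≡1 G dense L≤δn) ε (begin
      ℕ→ℚ L * (1ℚ + x * inv m) ^ℚ (suc m ℕ.* L) * inv m     ≤⟨ *-monoʳ {inv m} (0≤inv m) Lqᴺ≤εn ⟩
      ε * ℕ→ℚ (suc m) * inv m            ≡⟨ solve 3 (λ ε ν w → ε :* ν :* w := ε :* (w :* ν)) refl ε (ℕ→ℚ (suc m)) (inv m) ⟩
      ε * (inv m * ℕ→ℚ (suc m))          ≡⟨ cong (ε *_) (inv-inverse m) ⟩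
      ε * 1ℚ                             ≡⟨ Qₚ.*-identityʳ ε ⟩
      ε                                  ∎)
    where open Qₚ.≤-Reasoning

theorem6 : (α c : ℚ) → 0ℚ < α → (cpos : 0ℚ < c) → c < α →
    (ε : ℚ) → 0ℚ < ε →
    Σ ℕ λ N → (n : ℕ) → N ≤ n → (G : Graph n) → MinDegreeAtLeast G α →
    (v : Fin n) → Σ (Strategy n) λ σ → Σ ℕ λ t →
    t ≤ n × CLnLe c cpos n (n ∸ t) × (1ℚ - ε) Q.≤ probAtMost G σ v t
theorem6 α c 0<α cpos c<α ε 0<ε = proj₁ size , play
  where
  -- A rational strictly between c and α: α - a leaves room for the edges lost to Breaker, and a > c
  -- makes x = 1 / a smaller than y = 1 / c.
  a = proj₁ (Qₚ.<-dense c<α)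
  c<a = proj₁ (proj₂ (Qₚ.<-dense c<α))
  recip = reciprocal (Qₚ.<-trans cpos c<a)
  x = proj₁ recip
  0≤x = Qₚ.<⇒≤ (proj₁ (proj₂ recip))
  y = proj₁ (reciprocal cpos)
  x<y : x < y
  x<y = reciprocal-antitone cpos (proj₁ (proj₂ recip)) c<a (proj₂ (proj₂ recip)) (proj₂ (proj₂ (reciprocal cpos)))
  size = targetSize {x} {y} {α - a} {ε} 0≤x x<y (0<difference (proj₂ (proj₂ (Qₚ.<-dense c<α)))) 0<ε
  play : (n : ℕ) → proj₁ size ≤ n → (G : Graph n) → MinDegreeAtLeast G α →
    (v : Fin n) → Σ (Strategy n) λ σ → Σ ℕ λ t →
    t ≤ n × CLnLe c cpos n (n ∸ t) × (1ℚ - ε) Q.≤ probAtMost G σ v t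
  play (suc m) N≤n G dense v = from (proj₂ size m N≤n)
    where
    from : TargetSize x y (α - a) ε m → Σ (Strategy (suc m)) λ σ → Σ ℕ λ t →
      t ≤ suc m × CLnLe c cpos (suc m) (suc m ∸ t) × (1ℚ - ε) Q.≤ probAtMost G σ v t
    -- With t = n - L, the number n - t is L again because L ≤ n.
    from size = Breaker.strategy G v , suc m ∸ L , ℕₚ.m∸n≤m (suc m) L
      , subst (CLnLe c cpos (suc m)) (≡-sym (ℕₚ.m∸[m∸n]≡n L≤n)) (LnLe⇒CLnLe cpos (suc m) L ln≤yL)
      , breaker-wins {α} {a} {x} {y} {ε} 0≤x (proj₂ (proj₂ recip)) G dense v size
      where open TargetSize size
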